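{- A digraph $D$ of order $n$ is minimally strong subgraph $(2,n-2)$-connected if and only if $D$ is (isomorphic to) a digraph obtained from the complete digraph $\overleftrightarrow{K}_n$ by deleting an arc set $M$ such that $\overleftrightarrow{K}_n[M]$ is a (directed) 3-cycle or a union of $\lfloor n/2\rfloor$ vertex-disjoint (directed) 2-cycles. In particular, $f(n,2,n-2)=n(n-1)-2\lfloor n/2\rfloor$ and $F(n,2,n-2)=n(n-1)-3$.
   Context: Digraphs are finite, without loops and without parallel arcs (a pair of opposite arcs $xy$, $yx$ is allowed). A digraph is strong if it is strongly connected. For a digraph $D=(V,A)$ of order $n=|V|$ and a set $S\subseteq V$ with $|S|=k$, $2\le k\le n$, strong subgraphs $D_1,\dots,D_p$ of $D$ containing $S$ are internally disjoint if $V(D_i)\cap V(D_j)=S$ and $A(D_i)\cap A(D_j)=\emptyset$ for all $1\le i<j\le p$. $\kappa_S(D)$ is the maximum number of internally disjoint strong subgraphs of $D$ containing $S$ (it is $0$ if there are none). The strong subgraph $k$-connectivity is $\kappa_k(D)=\min\{\kappa_S(D)\mid S\subseteq V,\ |S|=k\}$. A digraph $D$ is minimally strong subgraph $(k,\ell)$-connected if $\kappa_k(D)\ge \ell$ but $\kappa_k(D-e)\le \ell-1$ for every arc $e\in A(D)$. $\mathfrak{F}(n,k,\ell)$ is the set of all minimally strong subgraph $(k,\ell)$-connected digraphs of order $n$; when this set is nonempty, $F(n,k,\ell)=\max\{|A(D)|\mid D\in\mathfrak{F}(n,k,\ell)\}$ and $f(n,k,\ell)=\min\{|A(D)|\mid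 D\in\mathfrak{F}(n,k,\ell)\}$. $\overleftrightarrow{K}_n$ is the complete digraph on $n$ vertices (both arcs $xy$ and $yx$ for every pair of distinct vertices), and $\overleftrightarrow{K}_n[M]$ is the subdigraph of $\overleftrightarrow{K}_n$ induced by the arc set $M$ (arc set $M$, vertices those incident with arcs of $M$). A directed 2-cycle is a pair of opposite arcs $xy,yx$.
   Formalization: The formulas for f(n,2,n-2) and F(n,2,n-2) are stated only for n ≥ 4: for n = 3 the family is the 3-cycle (3 arcs) and the bidirected path (4 arcs), so f = 3 and F = 4, and for n = 2 the formula for F gives -1; the equivalence is stated for all n ≥ 2. -}

module Defs where

open import Data.Fin using (Fin; combine; remQuot; _≟_)
open import Data.Fin.Permutation using (Permutation′; _⟨$⟩ʳ_)
open import Data.Fin.Properties using (any?; remQuot-combine)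
open import Data.Fin.Subset
open import Data.Fin.Subset.Properties using (_∈?_; p─q⊆p)
open import Data.List using (tabulate)
open import Data.Nat using (ℕ; _*_; _≤_; _<_)
open import Data.Product using (Σ; ∃-syntax; _×_; _,_; proj₁; proj₂)
open import Data.Sum using (_⊎_; inj₁; inj₂)
import Data.Vec as Vec
open import Data.Vec.Properties using ([]=⇒lookup; lookup⇒[]=; lookup∘tabulate)
open import Function using (_∘_)
open import Function.Bundles using (_⇔_)
open import Relation.Binary.Construct.Closure.ReflexiveTransitive using (Star)
open import Relation.Binary.PropositionalEquality
  using (_≡_; _≢_; sym; trans; cong)
open import Relation.Nullary using (Dec; does; yes; no; ¬?; _⊎-dec_)
open import Relation.Nullary.Decidable using (dec-true)

-- A maximum (minimum) is given as a relation rather than a function; m is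
-- unique if it exists.

IsMaximum : (ℕ → Set) → ℕ → Set
IsMaximum P m = P m × (∀ p → P p → p ≤ m)

IsMinimum : (ℕ → Set) → ℕ → Set
IsMinimum P m = P m × (∀ p → P p → m ≤ p)

⟦_⟧ : ∀ {n} {P : Fin n → Set} → (∀ x → Dec (P x)) → Subset n
⟦ P? ⟧ = Vec.tabulate (does ∘ P?)

module _ {n} {P : Fin n → Set} (P? : ∀ x → Dec (P x)) where

  ∈⟦⟧⁺ : ∀ {x} → P x → x ∈ ⟦ P? ⟧
  ∈⟦⟧⁺ {x} px = lookup⇒[]= x _
    (trans (lookup∘tabulate (does ∘ P?) x) (dec-true (P? x) px))

  ∈⟦⟧⁻ : ∀ {x} → x ∈ ⟦ P? ⟧ → P x
  ∈⟦⟧⁻ {x} x∈ with P? x | trans (sym (lookup∘tabulate (does ∘ P?) x)) ([]=⇒lookup x∈)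
  ... | yes px | _  = px
  ... | no _   | ()

-- Ordered pairs of vertices are encoded in Fin (n * n) by the library's
-- bijection combine/remQuot, so that a set of arcs is a library Subset.

ArcSet : ℕ → Set
ArcSet n = Subset (n * n)

infix 8 _⟶_

_⟶_ : ∀ {n} → Fin n → Fin n → Fin (n * n)
_⟶_ = combine

tail head : ∀ {n} → Fin (n * n) → Fin n
tail {n} e = proj₁ (remQuot {n} n e)
head {n} e = proj₂ (remQuot {n} n e)

record Digraph (n : ℕ) : Set where
  constructor digraph
  field
    arcs     : ArcSet n
    loopless : ∀ (x : Fin n) → x ⟶ x ∉ arcs

open Digraph public using (arcs; loopless)

size : ∀ {n} → Digraph n → ℕ
size D = ∣ arcs D ∣

infixl 5 _∖_

_∖_ : ∀ {n} → Digraph n → ArcSet n → Digraph n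
_∖_ {n} D M = digraph {n} (arcs D ─ M) (λ x → loopless D x ∘ p─q⊆p (arcs D) M)

infix 4 _≅_

_≅_ : ∀ {n} → Digraph n → Digraph n → Set
_≅_ {n} D E = Σ (Permutation′ n) λ σ → ∀ x y →
  (x ⟶ y ∈ arcs D) ⇔ ((σ ⟨$⟩ʳ x) ⟶ (σ ⟨$⟩ʳ y) ∈ arcs E)

notLoop? : ∀ {n} (e : Fin (n * n)) → Dec (tail {n} e ≢ head {n} e)
notLoop? {n} e = ¬? (tail {n} e ≟ head {n} e)

K : ∀ n → Digraph n
K n = digraph {n} ⟦ notLoop? {n} ⟧ λ x x∈ → ∈⟦⟧⁻ (notLoop? {n}) x∈
  (trans (cong proj₁ (remQuot-combine {n} x x))
         (sym (cong proj₂ (remQuot-combine {n} x x))))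

record Subgraph {n} (D : Digraph n) : Set where
  constructor subgraph
  field
    V        : Subset n
    A        : ArcSet n
    A⊆arcs   : A ⊆ arcs D
    incident : ∀ (x y : Fin n) → x ⟶ y ∈ A → x ∈ V × y ∈ V

open Subgraph public using (V; A; A⊆arcs; incident)

Incident : ∀ {n} → ArcSet n → Fin n → Set
Incident {n} M x = Σ (Fin n) λ y → (x ⟶ y ∈ M ⊎ y ⟶ x ∈ M)

incident? : ∀ {n} (M : ArcSet n) x → Dec (Incident {n} M x)
incident? {n} M x = any? λ y → (x ⟶ y ∈? M) ⊎-dec (y ⟶ x ∈? M)

-- The subdigraph usually written D[M].

arcInduced : ∀ {n} (D : Digraph n) (M : ArcSet n) → M ⊆ arcs D → Subgraph D
arcInduced {n} D M M⊆D = subgraph ⟦ incident? {n} M ⟧ M M⊆D λ x y xy∈M →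
  ∈⟦⟧⁺ (incident? {n} M) (y , inj₁ xy∈M) , ∈⟦⟧⁺ (incident? {n} M) (x , inj₂ xy∈M)

module _ {n} {D : Digraph n} where

  Strong : Subgraph D → Set
  Strong H = ∀ x y → x ∈ V H → y ∈ V H → Star (λ u v → u ⟶ v ∈ A H) x y

  IsDirected2Cycle : Subgraph D → Set
  IsDirected2Cycle H = ∃[ a ] ∃[ b ] (a ≢ b
    × V H ≡ ⁅ a ⁆ ∪ ⁅ b ⁆
    × A H ≡ ⁅ a ⟶ b ⁆ ∪ ⁅ b ⟶ a ⁆)

  IsDirected3Cycle : Subgraph D → Set
  IsDirected3Cycle H = ∃[ a ] ∃[ b ] ∃[ c ] (a ≢ b × b ≢ c × c ≢ a
    × V H ≡ ⁅ a ⁆ ∪ ⁅ b ⁆ ∪ ⁅ c ⁆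
    × A H ≡ ⁅ a ⟶ b ⁆ ∪ ⁅ b ⟶ c ⁆ ∪ ⁅ c ⟶ a ⁆)

  IsUnionOfDisjoint2Cycles : ℕ → Subgraph D → Set
  IsUnionOfDisjoint2Cycles q H = Σ (Fin q → Subgraph D) λ C →
      (∀ i → IsDirected2Cycle (C i))
    × (∀ i j → i ≢ j → Empty (V (C i) ∩ V (C j)))
    × V H ≡ ⋃ (tabulate (V ∘ C))
    × A H ≡ ⋃ (tabulate (A ∘ C))

InternallyDisjointStrong : ∀ {n} (D : Digraph n) (S : Subset n) {p : ℕ} →
                           (Fin p → Subgraph D) → Set
InternallyDisjointStrong D S H =
    (∀ i → Strong (H i) × S ⊆ V (H i))
  × (∀ i j → i ≢ j → V (H i) ∩ V (H j) ≡ S × Empty (A (H i) ∩ A (H j)))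

-- IsκS D S m  says  κ_S(D) = m.  The empty family (p = 0) is allowed, so the
-- value is 0 when no strong subgraph contains S.

IsκS : ∀ {n} → Digraph n → Subset n → ℕ → Set
IsκS D S = IsMaximum λ p → Σ (Fin p → Subgraph D) (InternallyDisjointStrong D S)

-- Isκ k D m  says  κ_k(D) = m  (meaningful for 2 ≤ k ≤ n).

Isκ : ∀ {n} → ℕ → Digraph n → ℕ → Set
Isκ {n} k D = IsMinimum λ m → Σ (Subset n) λ S → ∣ S ∣ ≡ k × IsκS D S m

-- The bound κ_k(D − e) ≤ ℓ − 1 is written m < ℓ to avoid truncated
-- subtraction when ℓ = 0.

MinimallyConnected : ∀ {n} → ℕ → ℕ → Digraph n → Set
MinimallyConnected k ℓ D =
    (∃[ m ] (Isκ k D m × ℓ ≤ m))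
  × (∀ e → e ∈ arcs D → ∃[ m ] (Isκ k (D ∖ ⁅ e ⁆) m × m < ℓ))

𝔉 : (n k ℓ : ℕ) → Set
𝔉 n k ℓ = Σ (Digraph n) (MinimallyConnected k ℓ)

-- IsF n k ℓ m  and  Isf n k ℓ m  say  F(n,k,ℓ) = m  and  f(n,k,ℓ) = m,
-- including that 𝔉(n,k,ℓ) is nonempty.

IsF Isf : (n k ℓ : ℕ) → ℕ → Set
IsF n k ℓ = IsMaximum λ m → Σ (𝔉 n k ℓ) λ D → size (proj₁ D) ≡ m
Isf n k ℓ = IsMinimum λ m → Σ (𝔉 n k ℓ) λ D → size (proj₁ D) ≡ m

{-# OPTIONS --safe #-}

-- A family of n − 2 internally disjoint strong subgraphs containing {x, y} is
-- obstructed when D lacks two arcs leaving (or entering) one vertex, a path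
-- a → x → y → b, or arcs between {x, y} and three further vertices. Hence, if
-- the missing arcs contain a path a → b → c with a ≠ c, they all lie on the
-- cycle abca; otherwise no two of them share a vertex unless they are opposite,
-- and they extend to ⌊n/2⌋ disjoint 2-cycles. Conversely, n − 2 subgraphs
-- survive the deletion of either pattern, and any further deletion creates an
-- obstruction, so that both patterns are exactly the extremal ones.

module Submission where

open import Defs
open import Data.Bool using (true; false)
open import Data.Empty using (⊥-elim) renaming (⊥ to Empty⊥)
open import Data.Fin using (Fin; zero; suc; splitAt; join; punchIn; punchOut; inject≤; _≟_)
open import Data.Fin.Permutation as Permutation
  using (Permutation′; _⟨$⟩ʳ_; _⟨$⟩ˡ_; inverseˡ; inverseʳ)
open import Data.Fin.Properties
  using (any?; injective⇒≤; join-splitAt; inject≤-injective; remQuot-combine;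
         combine-remQuot; combine-injective; combine-injectiveˡ; punchIn-injective;
         punchInᵢ≢i; punchIn-punchOut; punchOut-injective)
  renaming (suc-injective to Fin-suc-injective)
open import Data.Fin.Subset
open import Data.Fin.Subset.Properties
open import Data.List using (tabulate)
open import Data.Nat
  using (ℕ; zero; suc; _+_; _*_; _∸_; _≤_; _<_; z≤n; s≤s; ⌊_/2⌋; _≤?_)
open import Data.Nat.Properties
  using (+-comm; +-suc; +-cancelˡ-≤; +-∸-assoc; *-comm; *-distribˡ-∸; *-monoʳ-≤; ∸-monoʳ-≤;
         suc-injective; n≤1+n; 1+n≰n; ≤-refl; ≤-trans; ≤-reflexive; ≰⇒>; ⌊n/2⌋-mono)
open import Data.Product as Product using (Σ; ∃; ∃-syntax; _×_; _,_; proj₁; proj₂)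
open import Data.Sum as Sum using (_⊎_; inj₁; inj₂; [_,_]′)
open import Data.Vec using ([]; _∷_; here; there)
open import Data.Vec.Functional using () renaming (_∷_ to _∷ᶠ_; [] to []ᶠ)
open import Function using (_∘_; id)
open import Function.Bundles using (_⇔_; Equivalence; mk⇔)
open import Function.Definitions using (Injective)
open import Relation.Binary.Construct.Closure.ReflexiveTransitive as Star
  using (Star; ε; _◅_; _◅◅_)
open import Relation.Binary.PropositionalEquality
open import Relation.Nullary using (¬_; Dec; yes; no; ¬?; _×-dec_; _⊎-dec_; _→-dec_)
open import Relation.Nullary.Decidable using (decidable-stable)

-- The obstructions all come from one count over the `m = n − 2` vertices outside {x, y}. Internally
-- disjoint subgraphs have disjoint sets of private vertices, and a subgraph with no private vertex
-- must contain both xy and yx, so at most one is of that kind. A family of `m` subgraphs therefore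
-- takes one of two shapes: each has exactly one private vertex, or one is the bare 2-cycle on {x,
-- y} and the others share the `m` vertices with only one to spare. A vertex that lacks one of its
-- four arcs to and from x and y cannot be the only private vertex of a subgraph that uses neither
-- xy nor yx. Three such vertices exceed the room in either shape, but two can fit, and the
-- constructions use exactly this room. For the 3-cycle, each defective vertex takes one of xy and
-- yx. For the matching, the partners of x and y share one subgraph while another consists of xy and
-- yx alone.

private
  variable
    k m n p q : ℕ

-- Pigeonhole and cardinality

Inj : (Fin m → Fin n) → Set
Inj = Injective _≡_ _≡_

Inj-∷ : ∀ {a} {f : Fin m → Fin n} → (∀ i → a ≢ f i) → Inj f → Inj (a ∷ᶠ f)
Inj-∷ a≢f inj {zero}  {zero}  eq = refl
Inj-∷ a≢f inj {zero}  {suc j} eq = ⊥-elim (a≢f j eq)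
Inj-∷ a≢f inj {suc i} {zero}  eq = ⊥-elim (a≢f i (sym eq))
Inj-∷ a≢f inj {suc i} {suc j} eq = cong suc (inj eq)

Inj-disjoint⇒≤ : {f : Fin m → Fin n} {g : Fin k → Fin n} → Inj f → Inj g →
                 (∀ i j → f i ≢ g j) → m + k ≤ n
Inj-disjoint⇒≤ {m} {n} {k} {f} {g} f-inj g-inj f≢g = injective⇒≤ {f = h ∘ splitAt m} λ {i} {j} eq →
  trans (sym (join-splitAt m k i))
    (trans (cong (join m k) (h-inj (splitAt m i) (splitAt m j) eq)) (join-splitAt m k j))
  where
  h : Fin m ⊎ Fin k → Fin n
  h = [ f , g ]′
  h-inj : ∀ s t → h s ≡ h t → s ≡ t
  h-inj (inj₁ i) (inj₁ j) eq = cong inj₁ (f-inj eq)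
  h-inj (inj₁ i) (inj₂ j) eq = ⊥-elim (f≢g i j eq)
  h-inj (inj₂ i) (inj₁ j) eq = ⊥-elim (f≢g j i (sym eq))
  h-inj (inj₂ i) (inj₂ j) eq = cong inj₂ (g-inj eq)

pair-Inj : {a b : Fin n} → a ≢ b → Inj (a ∷ᶠ b ∷ᶠ []ᶠ)
pair-Inj a≢b = Inj-∷ (λ { zero → a≢b ; (suc ()) }) (Inj-∷ (λ ()) λ { {()} })

avoids-two⇒≤ : {f : Fin p → Fin (2 + m)} → Inj f → ∀ {a b} → a ≢ b →
               (∀ i → f i ≢ a) → (∀ i → f i ≢ b) → p ≤ m
avoids-two⇒≤ {p} {m} f-inj a≢b f≢a f≢b =
  +-cancelˡ-≤ 2 p m (subst (_≤ 2 + m) (+-comm p 2)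
    (Inj-disjoint⇒≤ f-inj (pair-Inj a≢b) λ { i zero → f≢a i ; i (suc zero) → f≢b i }))

-- An injection into two more points than it has arguments leaves out exactly two of them. This
-- stands in for surjectivity in the counting below.
hits-one-of-three : {f : Fin m → Fin (2 + m)} → Inj f → ∀ {a b c} → a ≢ b → a ≢ c → b ≢ c →
                    ∃ λ i → f i ≡ a ⊎ f i ≡ b ⊎ f i ≡ c
hits-one-of-three {m} {f} f-inj {a} {b} {c} a≢b a≢c b≢c
  with any? (λ i → f i ≟ a ⊎-dec f i ≟ b ⊎-dec f i ≟ c)
... | yes hit = hit
... | no miss = ⊥-elim (1+n≰n (subst (_≤ 2 + m) (+-comm m 3)
    (Inj-disjoint⇒≤ f-inj (Inj-∷ {a = a}
      (λ { zero → a≢b ; (suc zero) → a≢c ; (suc (suc ())) }) (pair-Inj b≢c))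
      λ { i zero eq → miss (i , inj₁ eq)
        ; i (suc zero) eq → miss (i , inj₂ (inj₁ eq))
        ; i (suc (suc zero)) eq → miss (i , inj₂ (inj₂ eq)) })))

∣p∪q∣≡∣p∣+∣q∣ : ∀ (p q : Subset n) → Empty (p ∩ q) → ∣ p ∪ q ∣ ≡ ∣ p ∣ + ∣ q ∣
∣p∪q∣≡∣p∣+∣q∣ []          []          _  = refl
∣p∪q∣≡∣p∣+∣q∣ (true  ∷ p) (true  ∷ q) p∩q≡∅ = ⊥-elim (p∩q≡∅ (zero , here))
∣p∪q∣≡∣p∣+∣q∣ (true  ∷ p) (false ∷ q) p∩q≡∅ = cong suc (∣p∪q∣≡∣p∣+∣q∣ p q (drop-∷-Empty p∩q≡∅))
∣p∪q∣≡∣p∣+∣q∣ (false ∷ p) (true  ∷ q) p∩q≡∅ =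
  trans (cong suc (∣p∪q∣≡∣p∣+∣q∣ p q (drop-∷-Empty p∩q≡∅))) (sym (+-suc ∣ p ∣ ∣ q ∣))
∣p∪q∣≡∣p∣+∣q∣ (false ∷ p) (false ∷ q) p∩q≡∅ = ∣p∪q∣≡∣p∣+∣q∣ p q (drop-∷-Empty p∩q≡∅)

∣⁅x⁆∪⁅y⁆∣≡2 : ∀ {x y : Fin n} → x ≢ y → ∣ ⁅ x ⁆ ∪ ⁅ y ⁆ ∣ ≡ 2
∣⁅x⁆∪⁅y⁆∣≡2 {x = x} {y} x≢y = trans
  (∣p∪q∣≡∣p∣+∣q∣ ⁅ x ⁆ ⁅ y ⁆ λ (z , z∈) → let z∈x , z∈y = x∈p∩q⁻ ⁅ x ⁆ ⁅ y ⁆ z∈ in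
    x≢y (trans (sym (x∈⁅y⁆⇒x≡y x z∈x)) (x∈⁅y⁆⇒x≡y y z∈y)))
  (cong₂ _+_ (∣⁅x⁆∣≡1 x) (∣⁅x⁆∣≡1 y))

∣p∣≡0⇒p≡⊥ : ∀ (p : Subset n) → ∣ p ∣ ≡ 0 → p ≡ ⊥
∣p∣≡0⇒p≡⊥ []          _  = refl
∣p∣≡0⇒p≡⊥ (false ∷ p) eq = cong (false ∷_) (∣p∣≡0⇒p≡⊥ p eq)

∣p∣≡1⇒p≡⁅x⁆ : ∀ (p : Subset n) → ∣ p ∣ ≡ 1 → ∃ λ x → p ≡ ⁅ x ⁆
∣p∣≡1⇒p≡⁅x⁆ (true  ∷ p) eq = zero , cong (true ∷_) (∣p∣≡0⇒p≡⊥ p (suc-injective eq))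
∣p∣≡1⇒p≡⁅x⁆ (false ∷ p) eq with x , refl ← ∣p∣≡1⇒p≡⁅x⁆ p eq = suc x , refl

∣p∣≡2⇒p≡⁅x⁆∪⁅y⁆ : ∀ (p : Subset n) → ∣ p ∣ ≡ 2 →
                  ∃ λ x → ∃ λ y → x ≢ y × p ≡ ⁅ x ⁆ ∪ ⁅ y ⁆
∣p∣≡2⇒p≡⁅x⁆∪⁅y⁆ (true  ∷ p) eq with y , refl ← ∣p∣≡1⇒p≡⁅x⁆ p (suc-injective eq) =
  zero , suc y , (λ ()) , cong (true ∷_) (sym (∪-identityˡ ⁅ y ⁆))
∣p∣≡2⇒p≡⁅x⁆∪⁅y⁆ (false ∷ p) eq with x , y , x≢y , refl ← ∣p∣≡2⇒p≡⁅x⁆∪⁅y⁆ p eq =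
  suc x , suc y , x≢y ∘ Fin-suc-injective , refl

x∈⁅x⁆∪⁅y⁆ : ∀ (x y : Fin n) → x ∈ ⁅ x ⁆ ∪ ⁅ y ⁆
x∈⁅x⁆∪⁅y⁆ x y = x∈p∪q⁺ (inj₁ (x∈⁅x⁆ x))

y∈⁅x⁆∪⁅y⁆ : ∀ (x y : Fin n) → y ∈ ⁅ x ⁆ ∪ ⁅ y ⁆
y∈⁅x⁆∪⁅y⁆ x y = x∈p∪q⁺ {p = ⁅ x ⁆} (inj₂ (x∈⁅x⁆ y))

∈⁅x⁆∪⁅y⁆⁻ : ∀ {x y z : Fin n} → z ∈ ⁅ x ⁆ ∪ ⁅ y ⁆ → z ≡ x ⊎ z ≡ y
∈⁅x⁆∪⁅y⁆⁻ {x = x} {y} z∈ with x∈p∪q⁻ ⁅ x ⁆ ⁅ y ⁆ z∈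
... | inj₁ z∈x = inj₁ (x∈⁅y⁆⇒x≡y x z∈x)
... | inj₂ z∈y = inj₂ (x∈⁅y⁆⇒x≡y y z∈y)

x∈p─q⇒x∉q : ∀ (p q : Subset n) {x} → x ∈ p ─ q → x ∉ q
x∈p─q⇒x∉q (_ ∷ p) (_ ∷ q) (there x∈) (there x∈q) = x∈p─q⇒x∉q p q x∈ x∈q

Family : Digraph n → Subset n → ℕ → Set
Family D S p = Σ (Fin p → Subgraph D) (InternallyDisjointStrong D S)

-- Vertex and arc sets are kept while the index set and the host digraph change, so one lemma serves
-- both for discarding members and for passing to a digraph with an arc deleted.
reindex : ∀ {D D′ : Digraph n} {S} ((H , _) : Family D S q) {ι : Fin p → Fin q} → Inj ι →
          (∀ i → A (H (ι i)) ⊆ arcs D′) → Family D′ S p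
reindex {D′ = D′} (H , strong , disjoint) {ι} ι-inj A⊆ =
  (λ i → subgraph {_} {D′} (V (H (ι i))) (A (H (ι i))) (A⊆ i) (incident (H (ι i)))) ,
  (strong ∘ ι) , (λ i j i≢j → disjoint (ι i) (ι j) (i≢j ∘ ι-inj))

Family-≤ : ∀ {D : Digraph n} {S} → p ≤ q → Family D S q → Family D S p
Family-≤ {D = D} p≤q F@(H , _) =
  reindex {D = D} {D} F {λ i → inject≤ i p≤q} (inject≤-injective p≤q p≤q _ _)
  λ i → A⊆arcs (H (inject≤ i p≤q))

-- Obstructions to n − 2 internally disjoint subgraphs

-- This expresses κ_2(D) < n - 2 by a pair without enough subgraphs, so that no maximum has to be
-- computed to assert it.
Obstructed : ∀ {m} → Digraph (2 + m) → Set
Obstructed {m} D = ∃ λ x → ∃ λ y → x ≢ y × ¬ Family D (⁅ x ⁆ ∪ ⁅ y ⁆) m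

last-step : ∀ {T : Fin n → Fin n → Set} {u v} → Star T u v → u ≢ v → ∃ λ w → T w v
last-step ε u≢v = ⊥-elim (u≢v refl)
last-step {v = v} (_◅_ {j = w} uw ws) u≢v with w ≟ v
... | yes refl = _ , uw
... | no w≢v   = last-step ws w≢v

loop-free : ∀ (D : Digraph n) {u v : Fin n} → u ⟶ v ∈ arcs D → u ≢ v
loop-free D {u} uv refl = loopless D u uv

module _ {D : Digraph n} (H : Subgraph D) (strong : Strong H) {s t}
         (s∈H : s ∈ V H) (t∈H : t ∈ V H) (s≢t : s ≢ t) where

  exit : ∃ λ w → s ⟶ w ∈ A H × w ∈ V H × w ≢ s
  exit with strong s t s∈H t∈H
  ... | ε = ⊥-elim (s≢t refl)
  ... | sw ◅ _ = _ , sw , proj₂ (incident H _ _ sw) , loop-free D (A⊆arcs H sw) ∘ sym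

  entry : ∃ λ w → w ⟶ s ∈ A H × w ∈ V H × w ≢ s
  entry with w , ws ← last-step (strong t s t∈H s∈H) (s≢t ∘ sym) =
    w , ws , proj₁ (incident H _ _ ws) , loop-free D (A⊆arcs H ws)

module InternallyDisjoint {D : Digraph n} {x y} (x≢y : x ≢ y)
                          (F : Family D (⁅ x ⁆ ∪ ⁅ y ⁆) p) where

  H = proj₁ F

  strong : ∀ i → Strong (H i)
  strong i = proj₁ (proj₁ (proj₂ F) i)

  x∈H : ∀ i → x ∈ V (H i)
  x∈H i = proj₂ (proj₁ (proj₂ F) i) (x∈⁅x⁆∪⁅y⁆ x y)

  y∈H : ∀ i → y ∈ V (H i)
  y∈H i = proj₂ (proj₁ (proj₂ F) i) (y∈⁅x⁆∪⁅y⁆ x y)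

  A-unique : ∀ {e i j} → e ∈ A (H i) → e ∈ A (H j) → i ≡ j
  A-unique {i = i} {j} e∈i e∈j with i ≟ j
  ... | yes i≡j = i≡j
  ... | no i≢j = ⊥-elim (proj₂ (proj₂ (proj₂ F) i j i≢j) (_ , x∈p∩q⁺ (e∈i , e∈j)))

  Private : Fin p → Fin n → Set
  Private i v = v ∈ V (H i) × v ≢ x × v ≢ y

  private? : ∀ i v → Dec (Private i v)
  private? i v = v ∈? V (H i) ×-dec ¬? (v ≟ x) ×-dec ¬? (v ≟ y)

  Private-unique : ∀ {i j v} → Private i v → Private j v → i ≡ j
  Private-unique {i} {j} (v∈i , v≢x , v≢y) (v∈j , _) with i ≟ j
  ... | yes i≡j = i≡j
  ... | no i≢j with ∈⁅x⁆∪⁅y⁆⁻ (subst (_ ∈_) (proj₁ (proj₂ (proj₂ F) i j i≢j)) (x∈p∩q⁺ (v∈i , v∈j)))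
  ...   | inj₁ v≡x = ⊥-elim (v≢x v≡x)
  ...   | inj₂ v≡y = ⊥-elim (v≢y v≡y)

  exit-x : ∀ i → x ⟶ y ∈ A (H i) ⊎ ∃ λ w → x ⟶ w ∈ A (H i) × Private i w
  exit-x i with exit (H i) (strong i) (x∈H i) (y∈H i) x≢y
  ... | w , xw , w∈ , w≢x with w ≟ y
  ...   | yes refl = inj₁ xw
  ...   | no w≢y = inj₂ (w , xw , w∈ , w≢x , w≢y)

  entry-x : ∀ i → y ⟶ x ∈ A (H i) ⊎ ∃ λ w → w ⟶ x ∈ A (H i) × Private i w
  entry-x i with entry (H i) (strong i) (x∈H i) (y∈H i) x≢y
  ... | w , wx , w∈ , w≢x with w ≟ y
  ...   | yes refl = inj₁ wx
  ...   | no w≢y = inj₂ (w , wx , w∈ , w≢x , w≢y)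

  exit-y : ∀ i → y ⟶ x ∈ A (H i) ⊎ ∃ λ w → y ⟶ w ∈ A (H i) × Private i w
  exit-y i with exit (H i) (strong i) (y∈H i) (x∈H i) (x≢y ∘ sym)
  ... | w , yw , w∈ , w≢y with w ≟ x
  ...   | yes refl = inj₁ yw
  ...   | no w≢x = inj₂ (w , yw , w∈ , w≢x , w≢y)

  entry-y : ∀ i → x ⟶ y ∈ A (H i) ⊎ ∃ λ w → w ⟶ y ∈ A (H i) × Private i w
  entry-y i with entry (H i) (strong i) (y∈H i) (x∈H i) (x≢y ∘ sym)
  ... | w , wy , w∈ , w≢y with w ≟ x
  ...   | yes refl = inj₁ wy
  ...   | no w≢x = inj₂ (w , wy , w∈ , w≢x , w≢y)

  -- Each member leaves x by an arc of its own, and distinct arcs out of x have distinct heads; the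
  -- outdegree of x thus bounds the family.
  out-neighbours : ∃ λ (f : Fin p → Fin n) → Inj f × ∀ i → x ⟶ f i ∈ arcs D
  out-neighbours = proj₁ ∘ out ,
    (λ {i} {j} eq → A-unique (proj₁ (proj₂ (out i)))
       (subst (λ w → x ⟶ w ∈ A (H j)) (sym eq) (proj₁ (proj₂ (out j))))) ,
    λ i → A⊆arcs (H i) (proj₁ (proj₂ (out i)))
    where
    out = λ i → exit (H i) (strong i) (x∈H i) (y∈H i) x≢y

  in-neighbours : ∃ λ (f : Fin p → Fin n) → Inj f × ∀ i → f i ⟶ x ∈ arcs D
  in-neighbours = proj₁ ∘ inn ,
    (λ {i} {j} eq → A-unique (proj₁ (proj₂ (inn i)))
       (subst (λ w → w ⟶ x ∈ A (H j)) (sym eq) (proj₁ (proj₂ (inn j))))) ,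
    λ i → A⊆arcs (H i) (proj₁ (proj₂ (inn i)))
    where
    inn = λ i → entry (H i) (strong i) (x∈H i) (y∈H i) x≢y

-- The inequality keeps loops, which are absent from every digraph, out of the missing arcs.
Missing : Digraph n → Fin n → Fin n → Set
Missing D u v = u ≢ v × u ⟶ v ∉ arcs D

-- A single missing arc already caps κ_2 at n - 2, since the heads of arcs leaving x avoid both x
-- and y. This supplies the upper bound for both patterns.
Family-≤-outdegree : ∀ {D : Digraph (2 + m)} {x y} → Missing D x y →
                     Family D (⁅ x ⁆ ∪ ⁅ y ⁆) p → p ≤ m
Family-≤-outdegree {D = D} {x} {y} (x≢y , xy∉) F =
  let f , f-inj , xf = InternallyDisjoint.out-neighbours x≢y F in
  avoids-two⇒≤ f-inj x≢y (λ i eq → loop-free D (xf i) (sym eq))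
    λ i eq → xy∉ (subst (λ w → x ⟶ w ∈ arcs D) eq (xf i))

-- The heads of the arcs leaving x must avoid x, u and v, which leaves too few for `m` distinct
-- ones.
two-missing-out : ∀ {D : Digraph (2 + m)} {x u v} → Missing D x u → Missing D x v → u ≢ v →
                  Obstructed D
two-missing-out {D = D} {x} {u} {v} (x≢u , xu∉) (x≢v , xv∉) u≢v = x , u , x≢u , λ F →
  let f , f-inj , xf = InternallyDisjoint.out-neighbours x≢u F
      misses = λ {w} (xw∉ : x ⟶ w ∉ arcs D) i (eq : f i ≡ w) →
                 xw∉ (subst (λ w → x ⟶ w ∈ arcs D) eq (xf i))
      i , hit = hits-one-of-three f-inj x≢u x≢v u≢v
  in [ misses (loopless D x) i , [ misses xu∉ i , misses xv∉ i ]′ ]′ hit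

two-missing-in : ∀ {D : Digraph (2 + m)} {x u v} → Missing D u x → Missing D v x → u ≢ v →
                 Obstructed D
two-missing-in {D = D} {x} {u} {v} (u≢x , ux∉) (v≢x , vx∉) u≢v = x , u , u≢x ∘ sym , λ F →
  let f , f-inj , fx = InternallyDisjoint.in-neighbours (u≢x ∘ sym) F
      misses = λ {w} (wx∉ : w ⟶ x ∉ arcs D) i (eq : f i ≡ w) →
                 wx∉ (subst (λ w → w ⟶ x ∈ arcs D) eq (fx i))
      i , hit = hits-one-of-three f-inj (u≢x ∘ sym) (v≢x ∘ sym) u≢v
  in [ misses (loopless D x) i , [ misses ux∉ i , misses vx∉ i ]′ ]′ hit

-- Families of exactly n - 2 members.

module Saturated {D : Digraph (2 + m)} {x y} (x≢y : x ≢ y) (F : Family D (⁅ x ⁆ ∪ ⁅ y ⁆) m) where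

  open InternallyDisjoint x≢y F public

  Spanned : Fin m → Set
  Spanned i = ∃ λ z → Private i z

  spanned? : ∀ i → Dec (Spanned i)
  spanned? i = any? (private? i)

  ¬spanned⇒xy∈ : ∀ i → ¬ Spanned i → x ⟶ y ∈ A (H i)
  ¬spanned⇒xy∈ i ¬s with exit-x i
  ... | inj₁ xy = xy
  ... | inj₂ (w , _ , w-private) = ⊥-elim (¬s (w , w-private))

  ¬spanned⇒yx∈ : ∀ i → ¬ Spanned i → y ⟶ x ∈ A (H i)
  ¬spanned⇒yx∈ i ¬s with exit-y i
  ... | inj₁ yx = yx
  ... | inj₂ (w , _ , w-private) = ⊥-elim (¬s (w , w-private))

  Only : Fin m → Fin (2 + m) → Set
  Only i z = ∀ w → Private i w → w ≡ z

  Blocked : Fin (2 + m) → Set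
  Blocked z = (z ≢ x × z ≢ y) ×
    ¬ (x ⟶ z ∈ arcs D × z ⟶ x ∈ arcs D × y ⟶ z ∈ arcs D × z ⟶ y ∈ arcs D)

  Direct : Fin m → Set
  Direct i = x ⟶ y ∈ A (H i) ⊎ y ⟶ x ∈ A (H i)

  -- Without xy and yx, both x and y would have to be left and entered through z, which takes all
  -- four arcs between z and {x, y}.
  blocked⇒direct : ∀ {i z} → Only i z → Blocked z → Direct i
  blocked⇒direct {i} {z} only (_ , blocked) with exit-x i
  ... | inj₁ xy = inj₁ xy
  ... | inj₂ (_ , xz , w) with refl ← only _ w with exit-y i
  ...   | inj₁ yx = inj₂ yx
  ...   | inj₂ (_ , yz , w) with refl ← only _ w with entry-x i
  ...     | inj₁ yx = inj₂ yx
  ...     | inj₂ (_ , zx , w) with refl ← only _ w with entry-y i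
  ...       | inj₁ xy = inj₁ xy
  ...       | inj₂ (_ , zy , w) with refl ← only _ w =
    ⊥-elim (blocked (A⊆arcs (H i) xz , A⊆arcs (H i) zx , A⊆arcs (H i) yz , A⊆arcs (H i) zy))

  module AllSpanned (spanned : ∀ i → Spanned i) where

    rep : Fin m → Fin (2 + m)
    rep = proj₁ ∘ spanned

    rep-private : ∀ i → Private i (rep i)
    rep-private = proj₂ ∘ spanned

    -- The `m` representatives are distinct and avoid x and y, so they exhaust the remaining
    -- vertices. Hence no subgraph has room for a second private vertex.
    rep-surjective : ∀ {z} → z ≢ x → z ≢ y → ∃ λ i → rep i ≡ z
    rep-surjective z≢x z≢y
      with hits-one-of-three (λ {i} {j} eq → Private-unique (rep-private i)
             (subst (Private j) (sym eq) (rep-private j))) x≢y (z≢x ∘ sym) (z≢y ∘ sym)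
    ... | i , inj₁ eq = ⊥-elim (proj₁ (proj₂ (rep-private i)) eq)
    ... | i , inj₂ (inj₁ eq) = ⊥-elim (proj₂ (proj₂ (rep-private i)) eq)
    ... | i , inj₂ (inj₂ eq) = i , eq

    rep-only : ∀ i → Only i (rep i)
    rep-only i w w-private@(_ , w≢x , w≢y) with j , refl ← rep-surjective w≢x w≢y =
      cong rep (Private-unique (rep-private j) w-private)

    spanned-by : ∀ {z} → z ≢ x → z ≢ y → ∃ λ i → Private i z × Only i z
    spanned-by z≢x z≢y with i , refl ← rep-surjective z≢x z≢y = i , rep-private i , rep-only i

    -- The three vertices lie in three different subgraphs, each of which needs one of the two arcs
    -- xy and yx.
    ¬three-blocked : ∀ {z₁ z₂ z₃} → Blocked z₁ → Blocked z₂ → Blocked z₃ →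
                     z₁ ≢ z₂ → z₁ ≢ z₃ → z₂ ≢ z₃ → Empty⊥
    ¬three-blocked b₁@((z₁≢x , z₁≢y) , _) b₂@((z₂≢x , z₂≢y) , _) b₃@((z₃≢x , z₃≢y) , _)
                   z₁≢z₂ z₁≢z₃ z₂≢z₃
      with i , _ , only-i ← spanned-by z₁≢x z₁≢y
         | j , pj , only-j ← spanned-by z₂≢x z₂≢y
         | k , pk , only-k ← spanned-by z₃≢x z₃≢y =
      collide (blocked⇒direct only-i b₁) (blocked⇒direct only-j b₂) (blocked⇒direct only-k b₃)
      where
      i≢j : i ≢ j
      i≢j refl = z₁≢z₂ (sym (only-i _ pj))
      i≢k : i ≢ k
      i≢k refl = z₁≢z₃ (sym (only-i _ pk))
      j≢k : j ≢ k
      j≢k refl = z₂≢z₃ (sym (only-j _ pk))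
      collide : Direct i → Direct j → Direct k → Empty⊥
      collide (inj₁ p) (inj₁ q) _        = i≢j (A-unique p q)
      collide (inj₁ p) (inj₂ q) (inj₁ r) = i≢k (A-unique p r)
      collide (inj₁ p) (inj₂ q) (inj₂ r) = j≢k (A-unique q r)
      collide (inj₂ p) (inj₂ q) _        = i≢j (A-unique p q)
      collide (inj₂ p) (inj₁ q) (inj₂ r) = i≢k (A-unique p r)
      collide (inj₂ p) (inj₁ q) (inj₁ r) = j≢k (A-unique q r)

  module OneUnspanned {i₀} (¬spanned : ¬ Spanned i₀) where

    direct⇒i₀ : ∀ {i} → Direct i → i ≡ i₀
    direct⇒i₀ (inj₁ xy) = A-unique xy (¬spanned⇒xy∈ i₀ ¬spanned)
    direct⇒i₀ (inj₂ yx) = A-unique yx (¬spanned⇒yx∈ i₀ ¬spanned)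

    -- The unspanned subgraph is represented by x, so that the representatives
    -- are injective into the vertices other than y and leave out only one.
    representative : ∀ i → ∃ λ v → (i ≡ i₀ × v ≡ x) ⊎ Private i v
    representative i with spanned? i
    ... | yes (v , v-private) = v , inj₂ v-private
    ... | no ¬s = x , inj₁ (direct⇒i₀ (inj₁ (¬spanned⇒xy∈ i ¬s)) , refl)

    rep : Fin m → Fin (2 + m)
    rep = proj₁ ∘ representative

    rep-private : ∀ {i} → rep i ≢ x → Private i (rep i)
    rep-private {i} rep≢x with proj₂ (representative i)
    ... | inj₁ (_ , eq) = ⊥-elim (rep≢x eq)
    ... | inj₂ v-private = v-private

    rep-injective : Inj rep
    rep-injective {i} {j} eq with proj₂ (representative i) | proj₂ (representative j)
    ... | inj₁ (i≡ , _) | inj₁ (j≡ , _) = trans i≡ (sym j≡)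
    ... | inj₁ (_ , v≡x) | inj₂ (_ , w≢x , _) = ⊥-elim (w≢x (trans (sym eq) v≡x))
    ... | inj₂ (_ , v≢x , _) | inj₁ (_ , w≡x) = ⊥-elim (v≢x (trans eq w≡x))
    ... | inj₂ v | inj₂ w = Private-unique v (subst (Private j) (sym eq) w)

    rep≢y : ∀ i → rep i ≢ y
    rep≢y i eq with proj₂ (representative i)
    ... | inj₁ (_ , v≡x) = x≢y (trans (sym v≡x) eq)
    ... | inj₂ (_ , _ , v≢y) = v≢y eq

    -- The representatives leave out exactly two vertices, one of which is y.
    hit-one-of : ∀ {z z′} → z ≢ z′ → z ≢ y → z′ ≢ y → ∃ λ i → rep i ≡ z ⊎ rep i ≡ z′
    hit-one-of z≢z′ z≢y z′≢y with hits-one-of-three rep-injective (z≢y ∘ sym) (z′≢y ∘ sym) z≢z′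
    ... | i , inj₁ eq  = ⊥-elim (rep≢y i eq)
    ... | i , inj₂ hit = i , hit

    -- A subgraph represented by a blocked vertex needs a second private vertex,
    -- which then represents nothing.
    Spare : Fin m → Set
    Spare i = ∃ λ w → Private i w × ∀ j → rep j ≢ w

    spare : ∀ {i z} → rep i ≡ z → Blocked z → Spare i
    spare {i} refl blocked@((z≢x , _) , _) with any? (λ w → private? i w ×-dec ¬? (w ≟ rep i))
    ... | yes (w , w-private , w≢rep) = w , w-private , unused
      where
      unused : ∀ j → rep j ≢ w
      unused j refl = w≢rep (cong rep
        (Private-unique (rep-private (proj₁ (proj₂ w-private))) w-private))
    -- If `rep i` were the only private vertex, being blocked it would force a direct arc and hence
    -- `i ≡ i₀`, but `i₀` has no private vertex.
    ... | no none = ⊥-elim (¬spanned (subst Spanned i≡i₀ (rep i , rep-private z≢x)))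
      where
      i≡i₀ : i ≡ i₀
      i≡i₀ = direct⇒i₀ (blocked⇒direct
        (λ w w-private → decidable-stable (w ≟ rep i) λ w≢rep →
          none (w , w-private , w≢rep)) blocked)

    ¬two-spare : ∀ {i j} → i ≢ j → Spare i → Spare j → Empty⊥
    ¬two-spare i≢j (v , v-private , v-unused) (w , w-private , w-unused)
      with hit-one-of (λ { refl → i≢j (Private-unique v-private w-private) })
             (proj₂ (proj₂ v-private)) (proj₂ (proj₂ w-private))
    ... | k , inj₁ eq = v-unused k eq
    ... | k , inj₂ eq = w-unused k eq

    ¬two-hit : ∀ {i j z z′} → z ≢ z′ → rep i ≡ z → Blocked z → rep j ≡ z′ → Blocked z′ → Empty⊥
    ¬two-hit z≢z′ refl b refl b′ = ¬two-spare (z≢z′ ∘ cong rep) (spare refl b) (spare refl b′)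

    -- Only one vertex other than y represents nothing, so at least two of the three are
    -- representatives. Each of them yields a spare vertex, and there is room for only one.
    ¬three-blocked : ∀ {z₁ z₂ z₃} → Blocked z₁ → Blocked z₂ → Blocked z₃ →
                     z₁ ≢ z₂ → z₁ ≢ z₃ → z₂ ≢ z₃ → Empty⊥
    ¬three-blocked b₁@((_ , z₁≢y) , _) b₂@((_ , z₂≢y) , _) b₃@((_ , z₃≢y) , _) z₁≢z₂ z₁≢z₃ z₂≢z₃
      with hit-one-of z₁≢z₂ z₁≢y z₂≢y
    ... | i , inj₁ i↦z₁ with hit-one-of z₂≢z₃ z₂≢y z₃≢y
    ...   | j , inj₁ j↦z₂ = ¬two-hit z₁≢z₂ i↦z₁ b₁ j↦z₂ b₂
    ...   | j , inj₂ j↦z₃ = ¬two-hit z₁≢z₃ i↦z₁ b₁ j↦z₃ b₃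
    ¬three-blocked b₁@((_ , z₁≢y) , _) b₂@((_ , z₂≢y) , _) b₃@((_ , z₃≢y) , _) z₁≢z₂ z₁≢z₃ z₂≢z₃
        | i , inj₂ i↦z₂ with hit-one-of z₁≢z₃ z₁≢y z₃≢y
    ...   | j , inj₁ j↦z₁ = ¬two-hit z₁≢z₂ j↦z₁ b₁ i↦z₂ b₂
    ...   | j , inj₂ j↦z₃ = ¬two-hit z₂≢z₃ i↦z₂ b₂ j↦z₃ b₃

  spanned-all? : (∀ i → Spanned i) ⊎ ∃ λ i → ¬ Spanned i
  spanned-all? with any? (¬? ∘ spanned?)
  ... | yes (i , ¬s) = inj₂ (i , ¬s)
  ... | no none = inj₁ λ i → decidable-stable (spanned? i) λ ¬s → none (i , ¬s)

  ¬three-blocked : ∀ {z₁ z₂ z₃} → Blocked z₁ → Blocked z₂ → Blocked z₃ →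
                   z₁ ≢ z₂ → z₁ ≢ z₃ → z₂ ≢ z₃ → Empty⊥
  ¬three-blocked with spanned-all?
  ... | inj₁ spanned = AllSpanned.¬three-blocked spanned
  ... | inj₂ (_ , ¬s) = OneUnspanned.¬three-blocked ¬s

-- As xy is missing, every subgraph has a private vertex, hence exactly one. The subgraph of a
-- cannot enter x from a, and the subgraph of b cannot leave y towards b. Both need yx, so they
-- coincide, against `a ≢ b`.
missing-path : ∀ {D : Digraph (2 + m)} {a x y b} →
               Missing D a x → Missing D x y → Missing D y b → a ≢ y → a ≢ b → b ≢ x →
               Obstructed D
missing-path {m} {D} {a} {x} {y} {b} (a≢x , ax∉) (x≢y , xy∉) (y≢b , yb∉) a≢y a≢b b≢x =
  x , y , x≢y , impossible
  where
  impossible : ¬ Family D (⁅ x ⁆ ∪ ⁅ y ⁆) m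
  impossible F with Saturated.spanned-all? x≢y F
  ... | inj₂ (i , ¬s) = xy∉ (A⊆arcs (H i) (¬spanned⇒xy∈ i ¬s))
    where open Saturated x≢y F
  ... | inj₁ spanned = collide (spanned-by a≢x a≢y) (spanned-by b≢x (y≢b ∘ sym))
    where
    open Saturated x≢y F
    open AllSpanned spanned
    collide : (∃ λ i → Private i a × Only i a) → (∃ λ j → Private j b × Only j b) → Empty⊥
    collide (i , a-private , only-a) (j , b-private , only-b) with entry-x i | exit-y j
    ... | inj₂ (_ , ax , w) | _ with refl ← only-a _ w = ax∉ (A⊆arcs (H i) ax)
    ... | inj₁ _ | inj₂ (_ , yb , w) with refl ← only-b _ w = yb∉ (A⊆arcs (H j) yb)
    ... | inj₁ yx | inj₁ yx′ with refl ← A-unique yx yx′ = a≢b (only-b _ a-private)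

three-blocked : ∀ {D : Digraph (2 + m)} {x y z₁ z₂ z₃} → x ≢ y →
                z₁ ≢ x → z₂ ≢ x → z₃ ≢ x → z₁ ≢ y → z₂ ≢ y → z₃ ≢ y →
                z₁ ≢ z₂ → z₁ ≢ z₃ → z₂ ≢ z₃ →
                (∀ {z} → z ≡ z₁ ⊎ z ≡ z₂ ⊎ z ≡ z₃ →
                  ¬ (x ⟶ z ∈ arcs D × z ⟶ x ∈ arcs D × y ⟶ z ∈ arcs D × z ⟶ y ∈ arcs D)) →
                Obstructed D
three-blocked {x = x} {y} x≢y 1≢x 2≢x 3≢x 1≢y 2≢y 3≢y 1≢2 1≢3 2≢3 blocked =
  x , y , x≢y , λ F → Saturated.¬three-blocked x≢y F
    ((1≢x , 1≢y) , blocked (inj₁ refl)) ((2≢x , 2≢y) , blocked (inj₂ (inj₁ refl)))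
    ((3≢x , 3≢y) , blocked (inj₂ (inj₂ refl))) 1≢2 1≢3 2≢3

Cyc : (a b c u v : Fin n) → Set
Cyc a b c u v = (u ≡ a × v ≡ b) ⊎ (u ≡ b × v ≡ c) ⊎ (u ≡ c × v ≡ a)

-- If uv starts at a or b, or ends at b or c, two missing arcs share a tail or a head. If only u = c
-- or only v = a, then uv prolongs the path abc to a path on four vertices. If uv avoids all three
-- vertices, then a, c and v are blocked for the pair {b, u}.
missing-2-path-and-arc : ∀ {D : Digraph (2 + m)} {a b c u v} →
  Missing D a b → Missing D b c → a ≢ c → Missing D u v → ¬ Cyc a b c u v → Obstructed D
missing-2-path-and-arc {D = D} {a} {b} {c} {u} {v} ab bc a≢c uv ¬cyc with u ≟ a
... | yes refl = two-missing-out {D = D} ab uv λ { refl → ¬cyc (inj₁ (refl , refl)) }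
... | no u≢a with u ≟ b
...   | yes refl = two-missing-out {D = D} bc uv λ { refl → ¬cyc (inj₂ (inj₁ (refl , refl))) }
...   | no u≢b with v ≟ b
...     | yes refl = two-missing-in {D = D} ab uv (u≢a ∘ sym)
...     | no v≢b with v ≟ c
...       | yes refl = two-missing-in {D = D} bc uv (u≢b ∘ sym)
...       | no v≢c with u ≟ c | v ≟ a
...         | yes refl | yes refl = ⊥-elim (¬cyc (inj₂ (inj₂ (refl , refl))))
...         | yes refl | no v≢a   = missing-path {D = D} ab bc uv a≢c (v≢a ∘ sym) v≢b
...         | no u≢c   | yes refl = missing-path {D = D} uv ab bc u≢b u≢c (a≢c ∘ sym)
...         | no u≢c   | no v≢a   = three-blocked {D = D} {b} {u} {a} {c} {v} (u≢b ∘ sym)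
              (proj₁ ab) (proj₁ bc ∘ sym) v≢b (u≢a ∘ sym) (u≢c ∘ sym) (proj₁ uv ∘ sym)
              a≢c (v≢a ∘ sym) (v≢c ∘ sym)
              λ { (inj₁ refl) (_ , a⟶b , _) → proj₂ ab a⟶b
                ; (inj₂ (inj₁ refl)) (b⟶c , _) → proj₂ bc b⟶c
                ; (inj₂ (inj₂ refl)) (_ , _ , u⟶v , _) → proj₂ uv u⟶v }

-- Families from vertex labellings

punchIn₂ : ∀ {x y : Fin (2 + m)} → x ≢ y → Fin m → Fin (2 + m)
punchIn₂ {x = x} x≢y = punchIn x ∘ punchIn (punchOut x≢y)

module _ {x y : Fin (2 + m)} (x≢y : x ≢ y) where

  punchIn₂-injective : Inj (punchIn₂ x≢y)
  punchIn₂-injective = punchIn-injective (punchOut x≢y) _ _ ∘ punchIn-injective x _ _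

  punchIn₂≢x : ∀ i → punchIn₂ x≢y i ≢ x
  punchIn₂≢x i = punchInᵢ≢i x (punchIn (punchOut x≢y) i)

  punchIn₂≢y : ∀ i → punchIn₂ x≢y i ≢ y
  punchIn₂≢y i eq = punchInᵢ≢i (punchOut x≢y) i
    (punchIn-injective x _ _ (trans eq (sym (punchIn-punchOut x≢y))))

  punchIn₂-surjective : ∀ {z} → z ≢ x → z ≢ y → ∃ λ i → punchIn₂ x≢y i ≡ z
  punchIn₂-surjective {z} z≢x z≢y = punchOut y′≢z′ ,
    trans (cong (punchIn x) (punchIn-punchOut y′≢z′)) (punchIn-punchOut (z≢x ∘ sym))
    where
    y′≢z′ : punchOut x≢y ≢ punchOut (z≢x ∘ sym)
    y′≢z′ eq = z≢y (sym (punchOut-injective x≢y (z≢x ∘ sym) eq))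

tail-⟶ : ∀ (u v : Fin n) → tail (u ⟶ v) ≡ u
tail-⟶ u v = cong proj₁ (remQuot-combine u v)

head-⟶ : ∀ (u v : Fin n) → head (u ⟶ v) ≡ v
head-⟶ {n} u v = cong proj₂ (remQuot-combine {n} u v)

tail⟶head : ∀ (e : Fin (n * n)) → tail {n} e ⟶ head {n} e ≡ e
tail⟶head {n} e = combine-remQuot {n} n e

module _ {R : Fin n → Fin n → Set} (R? : ∀ u v → Dec (R u v)) where

  arcSet : ArcSet n
  arcSet = ⟦ (λ e → R? (tail {n} e) (head {n} e)) ⟧

  ∈arcSet⁺ : ∀ {u v} → R u v → u ⟶ v ∈ arcSet
  ∈arcSet⁺ {u} {v} r = ∈⟦⟧⁺ (λ e → R? (tail {n} e) (head {n} e))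
    (subst₂ R (sym (tail-⟶ u v)) (sym (head-⟶ u v)) r)

  ∈arcSet⁻ : ∀ {u v} → u ⟶ v ∈ arcSet → R u v
  ∈arcSet⁻ {u} {v} uv∈ = subst₂ R (tail-⟶ u v) (head-⟶ u v)
    (∈⟦⟧⁻ (λ e → R? (tail {n} e) (head {n} e)) uv∈)

⊆-⟶ : ∀ {M N : ArcSet n} → (∀ (u v : Fin n) → u ⟶ v ∈ M → u ⟶ v ∈ N) → M ⊆ N
⊆-⟶ {n} {M} {N} M⊆N {e} e∈ = subst (_∈ N) (tail⟶head {n} e)
  (M⊆N (tail e) (head {n} e) (subst (_∈ M) (sym (tail⟶head {n} e)) e∈))

module Labelling (D : Digraph (2 + m)) {x y : Fin (2 + m)} (x≢y : x ≢ y)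
                 (label : Fin (2 + m) → Fin (2 + m)) (p q : Fin (2 + m)) where

  -- Every vertex outside {x, y} has one label, and the arcs xy and yx carry the
  -- labels p and q; subgraphs cut out by distinct labels are therefore
  -- internally disjoint. The labels are indexed by the vertices other than x
  -- and y.
  In : Fin (2 + m) → Fin (2 + m) → Set
  In i v = v ≡ x ⊎ v ≡ y ⊎ label v ≡ i

  Arc : Fin (2 + m) → Fin (2 + m) → Fin (2 + m) → Set
  Arc i u v = u ⟶ v ∈ arcs D × In i u × In i v ×
              (u ≡ x → v ≡ y → p ≡ i) × (u ≡ y → v ≡ x → q ≡ i)

  in? : ∀ i v → Dec (In i v)
  in? i v = v ≟ x ⊎-dec v ≟ y ⊎-dec label v ≟ i

  arc? : ∀ i u v → Dec (Arc i u v)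
  arc? i u v = u ⟶ v ∈? arcs D ×-dec in? i u ×-dec in? i v ×-dec
    (u ≟ x →-dec v ≟ y →-dec p ≟ i) ×-dec (u ≟ y →-dec v ≟ x →-dec q ≟ i)

  arc-xy : ∀ {i} → p ≡ i → x ⟶ y ∈ arcs D → Arc i x y
  arc-xy p≡i xy = xy , inj₁ refl , inj₂ (inj₁ refl) , (λ _ _ → p≡i) , λ x≡y → ⊥-elim (x≢y x≡y)

  arc-yx : ∀ {i} → q ≡ i → y ⟶ x ∈ arcs D → Arc i y x
  arc-yx q≡i yx = yx , inj₂ (inj₁ refl) , inj₁ refl , (λ y≡x → ⊥-elim (x≢y (sym y≡x))) , λ _ _ → q≡i

  module _ {i v : Fin (2 + m)} (v≢x : v ≢ x) (v≢y : v ≢ y) (lv≡i : label v ≡ i) where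

    arc-out : ∀ {u} → v ⟶ u ∈ arcs D → In i u → Arc i v u
    arc-out vu u∈ = vu , inj₂ (inj₂ lv≡i) , u∈ ,
      (λ v≡x → ⊥-elim (v≢x v≡x)) , λ v≡y → ⊥-elim (v≢y v≡y)

    arc-in : ∀ {u} → u ⟶ v ∈ arcs D → In i u → Arc i u v
    arc-in uv u∈ = uv , u∈ , inj₂ (inj₂ lv≡i) ,
      (λ _ v≡y → ⊥-elim (v≢y v≡y)) , λ _ v≡x → ⊥-elim (v≢x v≡x)

  H : Fin (2 + m) → Subgraph D
  H i = subgraph ⟦ in? i ⟧ (arcSet (arc? i))
    (⊆-⟶ {2 + m} λ u v → proj₁ ∘ ∈arcSet⁻ (arc? i) {u} {v})
    λ u v uv∈ → let _ , u∈ , v∈ , _ = ∈arcSet⁻ (arc? i) uv∈ in ∈⟦⟧⁺ (in? i) u∈ , ∈⟦⟧⁺ (in? i) v∈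

  -- Since x lies in every subgraph, it serves as a hub: strong connectivity follows from paths to
  -- and from x.
  Linked : Fin (2 + m) → Fin (2 + m) → Set
  Linked i v = Star (Arc i) x v × Star (Arc i) v x

  private
    S = ⁅ x ⁆ ∪ ⁅ y ⁆

    S⊆H : ∀ i → S ⊆ V (H i)
    S⊆H i z∈ with ∈⁅x⁆∪⁅y⁆⁻ z∈
    ... | inj₁ refl = ∈⟦⟧⁺ (in? i) (inj₁ refl)
    ... | inj₂ refl = ∈⟦⟧⁺ (in? i) (inj₂ (inj₁ refl))

    In-shared : ∀ {i j v} → i ≢ j → In i v → In j v → v ≡ x ⊎ v ≡ y
    In-shared i≢j (inj₁ v≡x) _ = inj₁ v≡x
    In-shared i≢j (inj₂ (inj₁ v≡y)) _ = inj₂ v≡y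
    In-shared i≢j (inj₂ (inj₂ _)) (inj₁ v≡x) = inj₁ v≡x
    In-shared i≢j (inj₂ (inj₂ _)) (inj₂ (inj₁ v≡y)) = inj₂ v≡y
    In-shared i≢j (inj₂ (inj₂ lv≡i)) (inj₂ (inj₂ lv≡j)) = ⊥-elim (i≢j (trans (sym lv≡i) lv≡j))

    Arc-not-shared : ∀ {i j u v} → i ≢ j → Arc i u v → ¬ Arc j u v
    Arc-not-shared i≢j (uv , u∈i , v∈i , xy-i , yx-i) (_ , u∈j , v∈j , xy-j , yx-j)
      with In-shared i≢j u∈i u∈j | In-shared i≢j v∈i v∈j
    ... | inj₁ refl | inj₁ refl = loopless D x uv
    ... | inj₁ refl | inj₂ refl = i≢j (trans (sym (xy-i refl refl)) (xy-j refl refl))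
    ... | inj₂ refl | inj₁ refl = i≢j (trans (sym (yx-i refl refl)) (yx-j refl refl))
    ... | inj₂ refl | inj₂ refl = loopless D y uv

    H-disjoint : ∀ {i j} → i ≢ j → V (H i) ∩ V (H j) ≡ S × Empty (A (H i) ∩ A (H j))
    H-disjoint {i} {j} i≢j =
      ⊆-antisym V∩V⊆S (λ z∈ → x∈p∩q⁺ (S⊆H i z∈ , S⊆H j z∈)) , no-common-arc
      where
      V∩V⊆S : V (H i) ∩ V (H j) ⊆ S
      V∩V⊆S z∈ with z∈i , z∈j ← x∈p∩q⁻ (V (H i)) (V (H j)) z∈
        with In-shared i≢j (∈⟦⟧⁻ (in? i) z∈i) (∈⟦⟧⁻ (in? j) z∈j)
      ... | inj₁ refl = x∈⁅x⁆∪⁅y⁆ x y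
      ... | inj₂ refl = y∈⁅x⁆∪⁅y⁆ x y
      no-common-arc : Empty (A (H i) ∩ A (H j))
      no-common-arc (e , e∈) =
        let e∈i , e∈j = x∈p∩q⁻ (A (H i)) (A (H j)) e∈ in
        Arc-not-shared i≢j (∈⟦⟧⁻ (λ e → arc? i (tail {2 + m} e) (head {2 + m} e)) e∈i)
                           (∈⟦⟧⁻ (λ e → arc? j (tail {2 + m} e) (head {2 + m} e)) e∈j)

  family : (∀ i → i ≢ x → i ≢ y → Linked i y) →
           (∀ i v → i ≢ x → i ≢ y → v ≢ x → v ≢ y → label v ≡ i → Linked i v) →
           Family D (⁅ x ⁆ ∪ ⁅ y ⁆) m
  family y-linked linked = H ∘ index ,
    (λ i → (λ u v u∈ v∈ → Star.gmap id (∈arcSet⁺ (arc? (index i)))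
              (proj₂ (link i u∈) ◅◅ proj₁ (link i v∈))) , S⊆H (index i)) ,
    λ i j i≢j → H-disjoint (i≢j ∘ punchIn₂-injective x≢y)
    where
    index : Fin m → Fin (2 + m)
    index = punchIn₂ x≢y
    link : ∀ i {v} → v ∈ V (H (index i)) → Linked (index i) v
    link i {v} v∈ with v ≟ x | v ≟ y
    ... | yes refl | _ = ε , ε
    ... | no _ | yes refl = y-linked (index i) (punchIn₂≢x x≢y i) (punchIn₂≢y x≢y i)
    ... | no v≢x | no v≢y with ∈⟦⟧⁻ (in? (index i)) v∈
    ...   | inj₁ v≡x = ⊥-elim (v≢x v≡x)
    ...   | inj₂ (inj₁ v≡y) = ⊥-elim (v≢y v≡y)
    ...   | inj₂ (inj₂ eq) = linked (index i) v (punchIn₂≢x x≢y i) (punchIn₂≢y x≢y i) v≢x v≢y eq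

Joined : Digraph n → Fin n → Fin n → Set
Joined D u v = u ⟶ v ∈ arcs D × v ⟶ u ∈ arcs D

-- These are ways to span {x, y, z} strongly with z as the only private vertex. The parameters `p`
-- and `q` name the vertices to which xy and yx are allotted, so each direct arc serves one z; only
-- `via` uses neither.
data Route (D : Digraph n) (x y p q z : Fin n) : Set where
  via    : Joined D x z → Joined D y z → Route D x y p q z
  cycle  : p ≡ z → x ⟶ y ∈ arcs D → y ⟶ z ∈ arcs D → z ⟶ x ∈ arcs D → Route D x y p q z
  cycle′ : q ≡ z → y ⟶ x ∈ arcs D → x ⟶ z ∈ arcs D → z ⟶ y ∈ arcs D → Route D x y p q z
  pend-x : p ≡ z → q ≡ z → Joined D x y → Joined D x z → Route D x y p q z
  pend-y : p ≡ z → q ≡ z → Joined D x y → Joined D y z → Route D x y p q z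

routes⇒family : ∀ (D : Digraph (2 + m)) {x y} → x ≢ y → ∀ p q →
                (∀ z → z ≢ x → z ≢ y → Route D x y p q z) → Family D (⁅ x ⁆ ∪ ⁅ y ⁆) m
routes⇒family {m} D {x} {y} x≢y p q route = family
  (λ z z≢x z≢y → proj₁ (links z≢x z≢y (route z z≢x z≢y)))
  (λ { z _ z≢x z≢y _ _ refl → proj₂ (links z≢x z≢y (route z z≢x z≢y)) })
  where
  open Labelling D x≢y id p q
  links : ∀ {z} → z ≢ x → z ≢ y → Route D x y p q z → Linked z y × Linked z z
  links {z} z≢x z≢y = λ where
      (via (xz , zx) (yz , zy)) →
        (x⟶z xz ◅ z⟶y zy ◅ ε , y⟶z yz ◅ z⟶x zx ◅ ε) , (x⟶z xz ◅ ε , z⟶x zx ◅ ε)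
      (cycle p≡z xy yz zx) →
        (arc-xy p≡z xy ◅ ε , y⟶z yz ◅ z⟶x zx ◅ ε) ,
        (arc-xy p≡z xy ◅ y⟶z yz ◅ ε , z⟶x zx ◅ ε)
      (cycle′ q≡z yx xz zy) →
        (x⟶z xz ◅ z⟶y zy ◅ ε , arc-yx q≡z yx ◅ ε) ,
        (x⟶z xz ◅ ε , z⟶y zy ◅ arc-yx q≡z yx ◅ ε)
      (pend-x p≡z q≡z (xy , yx) (xz , zx)) →
        (arc-xy p≡z xy ◅ ε , arc-yx q≡z yx ◅ ε) , (x⟶z xz ◅ ε , z⟶x zx ◅ ε)
      (pend-y p≡z q≡z (xy , yx) (yz , zy)) →
        (arc-xy p≡z xy ◅ ε , arc-yx q≡z yx ◅ ε) ,
        (arc-xy p≡z xy ◅ y⟶z yz ◅ ε , z⟶y zy ◅ arc-yx q≡z yx ◅ ε)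
    where
    x⟶z : x ⟶ z ∈ arcs D → Arc z x z
    x⟶z xz = arc-in z≢x z≢y refl xz (inj₁ refl)
    y⟶z : y ⟶ z ∈ arcs D → Arc z y z
    y⟶z yz = arc-in z≢x z≢y refl yz (inj₂ (inj₁ refl))
    z⟶x : z ⟶ x ∈ arcs D → Arc z z x
    z⟶x zx = arc-out z≢x z≢y refl zx (inj₁ refl)
    z⟶y : z ⟶ y ∈ arcs D → Arc z z y
    z⟶y zy = arc-out z≢x z≢y refl zy (inj₂ (inj₁ refl))

-- Families when the missing arcs lie in a matching.

module WithoutMatching {R : Fin (2 + m) → Fin (2 + m) → Set} (R? : ∀ u v → Dec (R u v))
  (R-sym : ∀ {u v} → R u v → R v u) (R-functional : ∀ {u v w} → R u v → R u w → v ≡ w)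
  (D : Digraph (2 + m)) (full : ∀ {u v} → u ≢ v → ¬ R u v → u ⟶ v ∈ arcs D) where

  joined : ∀ {u v} → u ≢ v → ¬ R u v → Joined D u v
  joined u≢v ¬uv = full u≢v ¬uv , full (u≢v ∘ sym) (¬uv ∘ R-sym)

  redirect : ∀ (a b v : Fin n) → ∃ λ w → (v ≡ a × w ≡ b) ⊎ (v ≢ a × w ≡ v)
  redirect a b v with v ≟ a
  ... | yes eq = b , inj₁ (eq , refl)
  ... | no v≢a = v , inj₂ (v≢a , refl)

  -- The partners x′ and y′ are each cut off from one of x and y, so neither works by `via`.
  -- Relabelling x′ as y′ puts both into one subgraph along x, y′, x′, y, in both directions. The
  -- label x′ is thereby freed for the 2-cycle on {x, y}.
  both-matched : ∀ {x y x′ y′} → x ≢ y → ¬ R x y → R x x′ → R y y′ → x ≢ x′ → y ≢ y′ →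
                 Family D (⁅ x ⁆ ∪ ⁅ y ⁆) m
  both-matched {x} {y} {x′} {y′} x≢y ¬xy xx′ yy′ x≢x′ y≢y′ = family
    (λ i i≢x i≢y → y-linked i≢x i≢y)
    (λ i v i≢x i≢y → linked i≢x i≢y)
    where
    label : Fin (2 + m) → Fin (2 + m)
    label = proj₁ ∘ redirect x′ y′
    open Labelling D x≢y label x′ x′
    x′≢y : x′ ≢ y
    x′≢y refl = ¬xy xx′
    y′≢x : y′ ≢ x
    y′≢x refl = ¬xy (R-sym yy′)
    x′≢y′ : x′ ≢ y′
    x′≢y′ refl = x≢y (R-functional (R-sym xx′) (R-sym yy′))
    label-x′ : label x′ ≡ y′
    label-x′ with proj₂ (redirect x′ y′ x′)
    ... | inj₁ (_ , eq) = eq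
    ... | inj₂ (x′≢x′ , _) = ⊥-elim (x′≢x′ refl)
    label-≢ : ∀ {v} → v ≢ x′ → label v ≡ v
    label-≢ {v} v≢x′ with proj₂ (redirect x′ y′ v)
    ... | inj₁ (v≡x′ , _) = ⊥-elim (v≢x′ v≡x′)
    ... | inj₂ (_ , eq) = eq
    label-y′ : label y′ ≡ y′
    label-y′ = label-≢ (x′≢y′ ∘ sym)
    x-y′ : Joined D x y′
    x-y′ = joined (y′≢x ∘ sym) λ xy′ → x′≢y′ (R-functional xx′ xy′)
    x′-y′ : Joined D x′ y′
    x′-y′ = joined x′≢y′ λ x′y′ → y′≢x (R-functional x′y′ (R-sym xx′))
    x′-y : Joined D x′ y
    x′-y = joined x′≢y λ x′y → x≢y (R-functional (R-sym xx′) x′y)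
    x-y : Joined D x y
    x-y = joined x≢y ¬xy
    module Spokes {i} (i≢x : i ≢ x) (i≢y : i ≢ y) (i≢x′ : i ≢ x′) (i≢y′ : i ≢ y′) where
      ix : Joined D i x
      ix = joined i≢x λ ix → i≢x′ (R-functional (R-sym ix) xx′)
      iy : Joined D i y
      iy = joined i≢y λ iy → i≢y′ (R-functional (R-sym iy) yy′)
      li : label i ≡ i
      li = label-≢ i≢x′
    x′⟶y′⟶x : Star (Arc y′) x′ x
    x′⟶y′⟶x = arc-out (x≢x′ ∘ sym) x′≢y label-x′ (proj₁ x′-y′) (inj₂ (inj₂ label-y′)) ◅
      arc-out y′≢x (y≢y′ ∘ sym) label-y′ (proj₂ x-y′) (inj₁ refl) ◅ ε
    x⟶y′⟶x′ : Star (Arc y′) x x′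
    x⟶y′⟶x′ = arc-in y′≢x (y≢y′ ∘ sym) label-y′ (proj₁ x-y′) (inj₁ refl) ◅
      arc-in (x≢x′ ∘ sym) x′≢y label-x′ (proj₂ x′-y′) (inj₂ (inj₂ label-y′)) ◅ ε
    y-linked : ∀ {i} → i ≢ x → i ≢ y → Linked i y
    y-linked {i} i≢x i≢y with i ≟ x′ | i ≟ y′
    ... | yes refl | _ = arc-xy refl (proj₁ x-y) ◅ ε , arc-yx refl (proj₂ x-y) ◅ ε
    ... | no _ | yes refl =
      x⟶y′⟶x′ ◅◅ arc-out (x≢x′ ∘ sym) x′≢y label-x′ (proj₁ x′-y) (inj₂ (inj₁ refl)) ◅ ε ,
      arc-in (x≢x′ ∘ sym) x′≢y label-x′ (proj₂ x′-y) (inj₂ (inj₁ refl)) ◅ x′⟶y′⟶x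
    ... | no i≢x′ | no i≢y′ =
      arc-in i≢x i≢y li (proj₂ ix) (inj₁ refl) ◅
        arc-out i≢x i≢y li (proj₁ iy) (inj₂ (inj₁ refl)) ◅ ε ,
      arc-in i≢x i≢y li (proj₂ iy) (inj₂ (inj₁ refl)) ◅
        arc-out i≢x i≢y li (proj₁ ix) (inj₁ refl) ◅ ε
      where open Spokes i≢x i≢y i≢x′ i≢y′
    linked : ∀ {i v} → i ≢ x → i ≢ y → v ≢ x → v ≢ y → label v ≡ i → Linked i v
    linked {i} {v} i≢x i≢y v≢x v≢y lv≡i = link (v ≟ x′) (v ≟ y′)
      where
      link : Dec (v ≡ x′) → Dec (v ≡ y′) → Linked i v
      link (yes refl) _ with refl ← trans (sym label-x′) lv≡i = x⟶y′⟶x′ , x′⟶y′⟶x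
      link (no v≢x′) v≟y′ with refl ← trans (sym (label-≢ v≢x′)) lv≡i | v≟y′
      ... | yes refl = arc-in v≢x v≢y lv≡i (proj₁ x-y′) (inj₁ refl) ◅ ε ,
                       arc-out v≢x v≢y lv≡i (proj₂ x-y′) (inj₁ refl) ◅ ε
      ... | no v≢y′ = arc-in v≢x v≢y li (proj₂ ix) (inj₁ refl) ◅ ε ,
                      arc-out v≢x v≢y li (proj₁ ix) (inj₁ refl) ◅ ε
        where open Spokes v≢x v≢y v≢x′ v≢y′

  families : (∀ {u} → ¬ R u u) → ∀ {x y} → x ≢ y → Family D (⁅ x ⁆ ∪ ⁅ y ⁆) m
  families R-irrefl {x} {y} x≢y with R? x y
  -- The allotment to x is idle: no outside vertex equals x, so no subgraph receives a direct arc.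
  ... | yes xy = routes⇒family D x≢y x x λ z z≢x z≢y → via
    (joined (z≢x ∘ sym) λ xz → z≢y (R-functional xz xy))
    (joined (z≢y ∘ sym) λ yz → z≢x (R-functional yz (R-sym xy)))
  ... | no ¬xy with any? (R? x) | any? (R? y)
  ...   | yes (x′ , xx′) | yes (y′ , yy′) =
    both-matched x≢y ¬xy xx′ yy′ (λ { refl → R-irrefl xx′ }) (λ { refl → R-irrefl yy′ })
  -- Only x′ is defective; it hangs from y, and both direct arcs go to its subgraph to reach x.
  ...   | yes (x′ , xx′) | no ¬y = routes⇒family D x≢y x′ x′ route
    where
    route : ∀ z → z ≢ x → z ≢ y → Route D x y x′ x′ z
    route z z≢x z≢y with x′ ≟ z
    ... | yes eq = pend-y eq eq (joined x≢y ¬xy) (joined (z≢y ∘ sym) λ yz → ¬y (_ , yz))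
    ... | no x′≢z = via (joined (z≢x ∘ sym) λ xz → x′≢z (R-functional xx′ xz))
                        (joined (z≢y ∘ sym) λ yz → ¬y (_ , yz))
  ...   | no ¬x | yes (y′ , yy′) = routes⇒family D x≢y y′ y′ route
    where
    route : ∀ z → z ≢ x → z ≢ y → Route D x y y′ y′ z
    route z z≢x z≢y with y′ ≟ z
    ... | yes eq = pend-x eq eq (joined x≢y ¬xy) (joined (z≢x ∘ sym) λ xz → ¬x (_ , xz))
    ... | no y′≢z = via (joined (z≢x ∘ sym) λ xz → ¬x (_ , xz))
                        (joined (z≢y ∘ sym) λ yz → y′≢z (R-functional yy′ yz))
  ...   | no ¬x | no ¬y = routes⇒family D x≢y x x λ z z≢x z≢y → via
    (joined (z≢x ∘ sym) λ xz → ¬x (_ , xz)) (joined (z≢y ∘ sym) λ yz → ¬y (_ , yz))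

Family-swap : ∀ {D : Digraph n} {x y} → Family D (⁅ y ⁆ ∪ ⁅ x ⁆) p → Family D (⁅ x ⁆ ∪ ⁅ y ⁆) p
Family-swap {D = D} {x} {y} = subst (λ S → Family D S _) (∪-comm ⁅ y ⁆ ⁅ x ⁆)

-- Families when the missing arcs lie on a 3-cycle.

Distinct : (a b c : Fin n) → Set
Distinct a b c = a ≢ b × b ≢ c × c ≢ a

_∉₃_ : Fin n → Fin n × Fin n × Fin n → Set
u ∉₃ (a , b , c) = u ≢ a × u ≢ b × u ≢ c

Cyc-tail : ∀ {a b c u v : Fin n} → u ∉₃ (a , b , c) → ¬ Cyc a b c u v
Cyc-tail (u≢a , u≢b , u≢c) = λ where
  (inj₁ (u≡a , _)) → u≢a u≡a
  (inj₂ (inj₁ (u≡b , _))) → u≢b u≡b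
  (inj₂ (inj₂ (u≡c , _))) → u≢c u≡c

Cyc-head : ∀ {a b c u v : Fin n} → v ∉₃ (a , b , c) → ¬ Cyc a b c u v
Cyc-head (v≢a , v≢b , v≢c) = λ where
  (inj₁ (_ , v≡b)) → v≢b v≡b
  (inj₂ (inj₁ (_ , v≡c))) → v≢c v≡c
  (inj₂ (inj₂ (_ , v≡a))) → v≢a v≡a

Cyc-rotate : ∀ {a b c u v : Fin n} → Cyc a b c u v → Cyc b c a u v
Cyc-rotate (inj₁ ab) = inj₂ (inj₂ ab)
Cyc-rotate (inj₂ (inj₁ bc)) = inj₁ bc
Cyc-rotate (inj₂ (inj₂ ca)) = inj₂ (inj₁ ca)

module Without3Cycle (D : Digraph (2 + m)) where

  Full : (a b c : Fin (2 + m)) → Set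
  Full a b c = ∀ {u v} → u ≢ v → ¬ Cyc a b c u v → u ⟶ v ∈ arcs D

  rotate : ∀ {a b c} → Full a b c → Full b c a
  rotate full u≢v ¬cyc = full u≢v (¬cyc ∘ Cyc-rotate)

  reversed : ∀ {a b c} → Full a b c → Distinct a b c → b ⟶ a ∈ arcs D
  reversed full (a≢b , b≢c , c≢a) = full (a≢b ∘ sym) λ where
    (inj₁ (b≡a , _)) → a≢b (sym b≡a)
    (inj₂ (inj₁ (_ , a≡c))) → c≢a (sym a≡c)
    (inj₂ (inj₂ (b≡c , _))) → b≢c b≡c

  joined : ∀ {a b c u v} → Full a b c → u ≢ v → v ∉₃ (a , b , c) → Joined D u v
  joined full u≢v v∉ = full u≢v (Cyc-head v∉) , full (u≢v ∘ sym) (Cyc-tail v∉)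

  -- Only c is defective for the pair {a, b}. The reversed cycle b → a → c → b connects it, so ba is
  -- allotted to c, while the allotment of ab to a is idle.
  consecutive : ∀ {a b c} → Full a b c → Distinct a b c → Family D (⁅ a ⁆ ∪ ⁅ b ⁆) m
  consecutive {a} {b} {c} full abc@(a≢b , b≢c , c≢a) = routes⇒family D a≢b a c route
    where
    route : ∀ z → z ≢ a → z ≢ b → Route D a b a c z
    route z z≢a z≢b with c ≟ z
    ... | yes refl = cycle′ refl (reversed full abc) (reversed (rotate (rotate full)) (c≢a , a≢b , b≢c))
                       (reversed (rotate full) (b≢c , c≢a , a≢b))
    ... | no c≢z = via (joined full (z≢a ∘ sym) (z≢a , z≢b , c≢z ∘ sym))
                       (joined full (z≢b ∘ sym) (z≢a , z≢b , c≢z ∘ sym))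

  -- Here b may lack its arc from a, and c its arc to a. The cycles a → y → b → a and y → a → c → y
  -- repair this, each with one of the two direct arcs.
  one-outside : ∀ {a b c y} → Full a b c → Distinct a b c → y ∉₃ (a , b , c) →
                Family D (⁅ a ⁆ ∪ ⁅ y ⁆) m
  one-outside {a} {b} {c} {y} full abc@(a≢b , b≢c , c≢a) y∉@(y≢a , y≢b , y≢c) =
    routes⇒family D (y≢a ∘ sym) b c route
    where
    to-y : ∀ {u} → u ≢ y → Joined D u y
    to-y u≢y = joined full u≢y y∉
    route : ∀ z → z ≢ a → z ≢ y → Route D a y b c z
    route z z≢a z≢y with b ≟ z | c ≟ z
    ... | yes refl | _ = cycle refl (proj₁ (to-y (y≢a ∘ sym))) (proj₂ (to-y z≢y)) (reversed full abc)
    ... | no _ | yes refl = cycle′ refl (proj₂ (to-y (y≢a ∘ sym)))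
                              (reversed (rotate (rotate full)) (c≢a , a≢b , b≢c)) (proj₁ (to-y z≢y))
    ... | no b≢z | no c≢z = via (joined full (z≢a ∘ sym) (z≢a , b≢z ∘ sym , c≢z ∘ sym))
                                (joined full (z≢y ∘ sym) (z≢a , b≢z ∘ sym , c≢z ∘ sym))

  from-a : ∀ {a b c y} → Full a b c → Distinct a b c → a ≢ y → Family D (⁅ a ⁆ ∪ ⁅ y ⁆) m
  from-a {a} {b} {c} {y} full abc@(a≢b , b≢c , c≢a) a≢y with y ≟ b | y ≟ c
  ... | yes refl | _ = consecutive full abc
  ... | no _ | yes refl = Family-swap {D = D} (consecutive (rotate (rotate full)) (c≢a , a≢b , b≢c))
  ... | no y≢b | no y≢c = one-outside full abc (a≢y ∘ sym , y≢b , y≢c)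

  from-cycle : ∀ {a b c x y} → Full a b c → Distinct a b c → x ≢ y →
               x ≡ a ⊎ x ≡ b ⊎ x ≡ c → Family D (⁅ x ⁆ ∪ ⁅ y ⁆) m
  from-cycle full abc x≢y (inj₁ refl) = from-a full abc x≢y
  from-cycle full (a≢b , b≢c , c≢a) x≢y (inj₂ (inj₁ refl)) =
    from-a (rotate full) (b≢c , c≢a , a≢b) x≢y
  from-cycle full (a≢b , b≢c , c≢a) x≢y (inj₂ (inj₂ refl)) =
    from-a (rotate (rotate full)) (c≢a , a≢b , b≢c) x≢y

  families : ∀ {a b c} → Full a b c → Distinct a b c → ∀ {x y} → x ≢ y → Family D (⁅ x ⁆ ∪ ⁅ y ⁆) m
  families {a} {b} {c} full abc {x} {y} x≢y
    with x ≟ a ⊎-dec x ≟ b ⊎-dec x ≟ c | y ≟ a ⊎-dec y ≟ b ⊎-dec y ≟ c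
  ... | yes x∈ | _ = from-cycle full abc x≢y x∈
  ... | no _ | yes y∈ = Family-swap {D = D} (from-cycle full abc (x≢y ∘ sym) y∈)
  ... | no x∉ | no y∉ = routes⇒family D x≢y x x λ z z≢x z≢y → via (spoke x∉ z≢x) (spoke y∉ z≢y)
    where
    spoke : ∀ {u z} → ¬ (u ≡ a ⊎ u ≡ b ⊎ u ≡ c) → z ≢ u → Joined D u z
    spoke u∉ z≢u =
      let zu , uz = joined full z≢u (u∉ ∘ inj₁ , u∉ ∘ inj₂ ∘ inj₁ , u∉ ∘ inj₂ ∘ inj₂) in uz , zu

-- Extremal sets of missing arcs

record Complement (D : Digraph n) (R : Fin n → Fin n → Set) : Set where
  constructor complement
  field
    absent  : ∀ {u v} → R u v → Missing D u v
    present : ∀ {u v} → u ≢ v → ¬ R u v → u ⟶ v ∈ arcs D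

-- Both main fields are monotone: `families` speaks of every digraph whose missing arcs lie in R,
-- `obstructs` of every one that misses all of R. They therefore apply after the deletion of an arc
-- as well, which yields both directions of the characterisation for either pattern.
record Extremal (R : Fin (2 + m) → Fin (2 + m) → Set) : Set where
  field
    R?        : ∀ u v → Dec (R u v)
    R⇒≢       : ∀ {u v} → R u v → u ≢ v
    nonempty  : ∃ λ a → ∃ λ b → R a b
    families  : ∀ (D : Digraph (2 + m)) → (∀ {u v} → u ≢ v → ¬ R u v → u ⟶ v ∈ arcs D) →
                ∀ {x y} → x ≢ y → Family D (⁅ x ⁆ ∪ ⁅ y ⁆) m
    obstructs : ∀ (D : Digraph (2 + m)) → (∀ {u v} → R u v → Missing D u v) →
                ∀ {u v} → Missing D u v → ¬ R u v → Obstructed D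

-- From families and obstructions to values of κ_2.

κ₂≤-lower-bound : ∀ {D : Digraph n} → (∀ {x y} → x ≢ y → Family D (⁅ x ⁆ ∪ ⁅ y ⁆) q) →
                  ∀ p → (Σ (Subset n) λ S → ∣ S ∣ ≡ 2 × IsκS D S p) → q ≤ p
κ₂≤-lower-bound {q = q} F p (S , ∣S∣≡2 , _ , maximal) with ∣p∣≡2⇒p≡⁅x⁆∪⁅y⁆ S ∣S∣≡2
... | x , y , x≢y , refl = maximal q (F x≢y)

-- By disjointness at most one member contains the arc, and discarding that one suffices.
remove-arc : ∀ {D : Digraph n} {S} e → Family D S (suc p) → Family (D ∖ ⁅ e ⁆) S p
remove-arc {p = p} {D} {S} e F@(H , _ , disjoint) =
  drop (any? λ i → e ∈? A (H i))
  where
  drop-index : ∀ i → (∀ j → i ≢ j → e ∉ A (H j)) → Family (D ∖ ⁅ e ⁆) S p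
  drop-index i avoids = reindex {D = D} {D ∖ ⁅ e ⁆} F (punchIn-injective i _ _) λ j {a} a∈ →
    x∈p∧x∉q⇒x∈p─q (A⊆arcs (H (punchIn i j)) a∈) λ a∈e →
      avoids (punchIn i j) (punchInᵢ≢i i j ∘ sym)
        (subst (_∈ A (H (punchIn i j))) (x∈⁅y⁆⇒x≡y e a∈e) a∈)
  drop : Dec (∃ λ i → e ∈ A (H i)) → Family (D ∖ ⁅ e ⁆) S p
  drop (yes (i , e∈i)) = drop-index i λ j i≢j e∈j →
    proj₂ (disjoint i j i≢j) (e , x∈p∩q⁺ (e∈i , e∈j))
  -- No member contains the arc; an arbitrary one is discarded to reach the same size.
  drop (no none) = drop-index zero λ j _ e∈j → none (j , e∈j)

empty-family : ∀ {D : Digraph n} {S} → Family D S 0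
empty-family = (λ ()) , (λ ()) , λ ()

-- Minimality asks for the actual value after the deletion. Losing an arc costs at most one member
-- and the obstruction costs at least one, so the value drops by exactly one. For n = 2 the empty
-- family rules out any obstruction.
κ₂-of-obstructed-deletion : ∀ {D : Digraph (2 + m)} e →
  (∀ {x y} → x ≢ y → Family D (⁅ x ⁆ ∪ ⁅ y ⁆) m) →
  Obstructed (D ∖ ⁅ e ⁆) → ∃[ p ] (Isκ 2 (D ∖ ⁅ e ⁆) p × p < m)
κ₂-of-obstructed-deletion {zero} {D} e F (x , y , x≢y , ¬F) =
  ⊥-elim (¬F (empty-family {D = D ∖ ⁅ e ⁆}))
κ₂-of-obstructed-deletion {suc m} {D} e F (x , y , x≢y , ¬F) = m ,
  ((⁅ x ⁆ ∪ ⁅ y ⁆ , ∣⁅x⁆∪⁅y⁆∣≡2 x≢y , F′ x≢y , bound) , κ₂≤-lower-bound {D = D ∖ ⁅ e ⁆} F′) , ≤-refl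
  where
  F′ : ∀ {x y} → x ≢ y → Family (D ∖ ⁅ e ⁆) (⁅ x ⁆ ∪ ⁅ y ⁆) m
  F′ x≢y = remove-arc {D = D} e (F x≢y)
  bound : ∀ p → Family (D ∖ ⁅ e ⁆) (⁅ x ⁆ ∪ ⁅ y ⁆) p → p ≤ m
  bound p G with p ≤? m
  ... | yes p≤m = p≤m
  ... | no p≰m = ⊥-elim (¬F (Family-≤ {D = D ∖ ⁅ e ⁆} (≰⇒> p≰m) G))

Missing-delete : ∀ (D : Digraph n) e {u v : Fin n} → Missing D u v → Missing (D ∖ ⁅ e ⁆) u v
Missing-delete D e (u≢v , uv∉) = u≢v , uv∉ ∘ p─q⊆p (arcs D) ⁅ e ⁆

Missing-deleted : ∀ (D : Digraph n) {u v : Fin n} → u ≢ v → Missing (D ∖ ⁅ u ⟶ v ⁆) u v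
Missing-deleted D {u} {v} u≢v = u≢v , λ uv∈ → x∈p─q⇒x∉q (arcs D) ⁅ u ⟶ v ⁆ uv∈ (x∈⁅x⁆ (u ⟶ v))

Complement⇒MinimallyConnected : ∀ {D : Digraph (2 + m)} {R} → Extremal R → Complement D R →
                                MinimallyConnected 2 m D
Complement⇒MinimallyConnected {m} {D} {R} extremal (complement absent present) =
  (m , ((⁅ a ⁆ ∪ ⁅ b ⁆ , ∣⁅x⁆∪⁅y⁆∣≡2 (R⇒≢ ab) , F (R⇒≢ ab) ,
         λ p → Family-≤-outdegree (absent ab)) , κ₂≤-lower-bound F) , ≤-refl) , minimal
  where
  open Extremal extremal
  F : ∀ {x y} → x ≢ y → Family D (⁅ x ⁆ ∪ ⁅ y ⁆) m
  F = families D present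
  a b : Fin (2 + m)
  a = proj₁ nonempty
  b = proj₁ (proj₂ nonempty)
  ab : R a b
  ab = proj₂ (proj₂ nonempty)
  minimal-at : ∀ u v → u ⟶ v ∈ arcs D → ∃[ p ] (Isκ 2 (D ∖ ⁅ u ⟶ v ⁆) p × p < m)
  minimal-at u v uv∈ = κ₂-of-obstructed-deletion {D = D} (u ⟶ v) F
    (obstructs (D ∖ ⁅ u ⟶ v ⁆) (λ r → Missing-delete D (u ⟶ v) (absent r))
      {u} {v} (Missing-deleted D (loop-free D uv∈)) λ r → proj₂ (absent r) uv∈)
  minimal : ∀ e → e ∈ arcs D → ∃[ p ] (Isκ 2 (D ∖ ⁅ e ⁆) p × p < m)
  minimal e e∈ = subst (λ e → ∃[ p ] (Isκ 2 (D ∖ ⁅ e ⁆) p × p < m)) (tail⟶head {2 + m} e)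
    (minimal-at (tail e) (head {2 + m} e) (subst (_∈ arcs D) (sym (tail⟶head {2 + m} e)) e∈))

MinimallyConnected⇒¬Obstructed : ∀ {D : Digraph (2 + m)} → MinimallyConnected 2 m D → ¬ Obstructed D
MinimallyConnected⇒¬Obstructed {m} {D} ((κ , (_ , κ-minimal) , m≤κ) , _) (x , y , x≢y , ¬F) =
  impossible m ≤-refl ¬F
  where
  S = ⁅ x ⁆ ∪ ⁅ y ⁆
  -- If p were the largest size of a family then κ ≤ p < m; no largest size is
  -- ever computed, the claim being a negation.
  impossible : ∀ k → k ≤ m → ¬ ¬ Family D S k
  impossible zero    _   ¬F = ¬F (empty-family {D = D})
  impossible (suc p) p<m ¬F = impossible p (≤-trans (n≤1+n p) p<m) λ F →
    1+n≰n (≤-trans p<m (≤-trans m≤κ (κ-minimal p (S , ∣⁅x⁆∪⁅y⁆∣≡2 x≢y , F , bound))))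
    where
    bound : ∀ q → Family D S q → q ≤ p
    bound q G with q ≤? p
    ... | yes q≤p = q≤p
    ... | no q≰p = ⊥-elim (¬F (Family-≤ {D = D} (≰⇒> q≰p) G))

-- An arc of R still present could be deleted without leaving the range of `families`, so κ_2 would
-- not drop. Missing arcs that lie in R thus fill all of R.
MinimallyConnected⇒Complement : ∀ {D : Digraph (2 + m)} {R} → Extremal R →
  (∀ {u v} → Missing D u v → R u v) → MinimallyConnected 2 m D → Complement D R
MinimallyConnected⇒Complement {m} {D} {R} extremal missing⇒R (_ , minimal) = complement
  (λ {u} {v} r → R⇒≢ r , λ uv∈ → redundant u v r (minimal (u ⟶ v) uv∈))
  λ {u} {v} u≢v ¬r → decidable-stable (u ⟶ v ∈? arcs D) λ uv∉ → ¬r (missing⇒R (u≢v , uv∉))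
  where
  open Extremal extremal
  redundant : ∀ u v → R u v → ¬ (∃[ p ] (Isκ 2 (D ∖ ⁅ u ⟶ v ⁆) p × p < m))
  redundant u v r (p , (attained , _) , p<m) =
    1+n≰n (≤-trans p<m (κ₂≤-lower-bound {D = D ∖ ⁅ u ⟶ v ⁆}
      (families (D ∖ ⁅ u ⟶ v ⁆) present) p attained))
    where
    present : ∀ {s t} → s ≢ t → ¬ R s t → s ⟶ t ∈ arcs (D ∖ ⁅ u ⟶ v ⁆)
    present {s} {t} s≢t ¬r = x∈p∧x∉q⇒x∈p─q
      (decidable-stable (s ⟶ t ∈? arcs D) λ st∉ → ¬r (missing⇒R (s≢t , st∉)))
      λ st∈ → let s≡u , t≡v = combine-injective s t u v (x∈⁅y⁆⇒x≡y (u ⟶ v) st∈) in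
        ¬r (subst₂ R (sym s≡u) (sym t≡v) r)

Cyc? : ∀ (a b c u v : Fin n) → Dec (Cyc a b c u v)
Cyc? a b c u v = (u ≟ a ×-dec v ≟ b) ⊎-dec (u ≟ b ×-dec v ≟ c) ⊎-dec (u ≟ c ×-dec v ≟ a)

Cyc-extremal : ∀ {a b c : Fin (2 + m)} → Distinct a b c → Extremal (Cyc a b c)
Cyc-extremal {m} {a} {b} {c} abc@(a≢b , b≢c , c≢a) = record
  { R? = Cyc? a b c
  ; R⇒≢ = λ where
      (inj₁ (refl , refl)) → a≢b
      (inj₂ (inj₁ (refl , refl))) → b≢c
      (inj₂ (inj₂ (refl , refl))) → c≢a
  ; nonempty = a , b , inj₁ (refl , refl)
  ; families = λ D full → Without3Cycle.families D full abc
  ; obstructs = λ D missing uv ¬cyc → missing-2-path-and-arc {D = D}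
      (missing (inj₁ (refl , refl))) (missing (inj₂ (inj₁ (refl , refl)))) (c≢a ∘ sym) uv ¬cyc
  }

-- Matchings with ⌊n/2⌋ pairs.

record Matching (q n : ℕ) : Set where
  field
    l r   : Fin q → Fin n
    l-inj : Inj l
    r-inj : Inj r
    l≢r   : ∀ i j → l i ≢ r j

  Mate : Fin n → Fin n → Set
  Mate u v = ∃ λ i → (u ≡ l i × v ≡ r i) ⊎ (u ≡ r i × v ≡ l i)

  Mate? : ∀ u v → Dec (Mate u v)
  Mate? u v = any? λ i → (u ≟ l i ×-dec v ≟ r i) ⊎-dec (u ≟ r i ×-dec v ≟ l i)

  Mate-sym : ∀ {u v} → Mate u v → Mate v u
  Mate-sym (i , inj₁ (u≡l , v≡r)) = i , inj₂ (v≡r , u≡l)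
  Mate-sym (i , inj₂ (u≡r , v≡l)) = i , inj₁ (v≡l , u≡r)

  Mate-irrefl : ∀ {u} → ¬ Mate u u
  Mate-irrefl (i , inj₁ (u≡l , u≡r)) = l≢r i i (trans (sym u≡l) u≡r)
  Mate-irrefl (i , inj₂ (u≡r , u≡l)) = l≢r i i (trans (sym u≡l) u≡r)

  Mate-functional : ∀ {u v w} → Mate u v → Mate u w → v ≡ w
  Mate-functional (i , inj₁ (u≡ , v≡)) (j , inj₁ (u≡′ , w≡))
    with refl ← l-inj (trans (sym u≡) u≡′) = trans v≡ (sym w≡)
  Mate-functional (i , inj₁ (u≡ , v≡)) (j , inj₂ (u≡′ , w≡)) =
    ⊥-elim (l≢r i j (trans (sym u≡) u≡′))
  Mate-functional (i , inj₂ (u≡ , v≡)) (j , inj₁ (u≡′ , w≡)) =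
    ⊥-elim (l≢r j i (trans (sym u≡′) u≡))
  Mate-functional (i , inj₂ (u≡ , v≡)) (j , inj₂ (u≡′ , w≡))
    with refl ← r-inj (trans (sym u≡) u≡′) = trans v≡ (sym w≡)

  Covered : Fin n → Set
  Covered u = ∃ λ v → Mate u v

  two-uncovered⇒≤ : ∀ {u v} → u ≢ v → ¬ Covered u → ¬ Covered v → q + (2 + q) ≤ n
  two-uncovered⇒≤ {u} {v} u≢v ¬u ¬v = Inj-disjoint⇒≤ l-inj
    (Inj-∷ {a = u} (λ { zero → u≢v ; (suc i) u≡r → ¬u (l i , i , inj₂ (u≡r , refl)) })
      (Inj-∷ {a = v} (λ i v≡r → ¬v (l i , i , inj₂ (v≡r , refl))) r-inj))
    λ { i zero l≡u → ¬u (r i , i , inj₁ (sym l≡u , refl))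
      ; i (suc zero) l≡v → ¬v (r i , i , inj₁ (sym l≡v , refl))
      ; i (suc (suc j)) → l≢r i j }

n≤1+⌊n/2⌋+⌊n/2⌋ : ∀ n → n ≤ suc (⌊ n /2⌋ + ⌊ n /2⌋)
n≤1+⌊n/2⌋+⌊n/2⌋ zero          = z≤n
n≤1+⌊n/2⌋+⌊n/2⌋ (suc zero)    = ≤-refl
n≤1+⌊n/2⌋+⌊n/2⌋ (suc (suc n)) = s≤s (s≤s
  (subst (n ≤_) (sym (+-suc ⌊ n /2⌋ ⌊ n /2⌋)) (n≤1+⌊n/2⌋+⌊n/2⌋ n)))

module _ (P : Matching ⌊ 2 + m /2⌋ (2 + m)) where

  open Matching P

  one-covered : ∀ {u v} → u ≢ v → Covered u ⊎ Covered v
  one-covered {u} {v} u≢v with any? (Mate? u) | any? (Mate? v)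
  ... | yes cu | _ = inj₁ cu
  ... | no _ | yes cv = inj₂ cv
  -- Two uncovered vertices would need 2h + 2 ≤ n, against n ≤ 2h + 1.
  ... | no ¬u | no ¬v = ⊥-elim (1+n≰n (≤-trans
    (subst (3 + m ≤_) (sym (trans (+-suc h (suc h)) (cong suc (+-suc h h))))
      (s≤s (n≤1+⌊n/2⌋+⌊n/2⌋ (2 + m))))
    (two-uncovered⇒≤ u≢v ¬u ¬v)))
    where h = ⌊ 2 + m /2⌋

  Mate-extremal : Extremal Mate
  Mate-extremal = record
    { R? = Mate?
    ; R⇒≢ = λ { uv refl → Mate-irrefl uv }
    ; nonempty = l zero , r zero , zero , inj₁ (refl , refl)
    ; families = λ D full →
        WithoutMatching.families Mate? Mate-sym Mate-functional D full Mate-irrefl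
    ; obstructs = obstructs
    }
    where
    obstructs : ∀ (D : Digraph (2 + m)) → (∀ {u v} → Mate u v → Missing D u v) →
                ∀ {u v} → Missing D u v → ¬ Mate u v → Obstructed D
    obstructs D missing {u} {v} uv ¬mate with one-covered (proj₁ uv)
    -- The missing path w → u → v is joined by the opposite arc u → w of the matched pair, which is
    -- not on the cycle wuvw.
    ... | inj₁ (w , uw) = missing-2-path-and-arc {D = D} (missing (Mate-sym uw)) uv
      (λ { refl → ¬mate uw }) (missing uw) λ where
        (inj₁ (u≡w , _)) → proj₁ (missing uw) u≡w
        (inj₂ (inj₁ (_ , refl))) → ¬mate uw
        (inj₂ (inj₂ (u≡v , _))) → proj₁ uv u≡v
    ... | inj₂ (w , vw) = missing-2-path-and-arc {D = D} uv (missing vw)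
      (λ { refl → ¬mate (Mate-sym vw) }) (missing (Mate-sym vw)) λ where
        (inj₁ (refl , _)) → ¬mate (Mate-sym vw)
        (inj₂ (inj₁ (w≡v , _))) → proj₁ (missing vw) (sym w≡v)
        (inj₂ (inj₂ (_ , v≡u))) → proj₁ uv (sym v≡u)

module ExtendMatching {R : Fin n → Fin n → Set} (R? : ∀ u v → Dec (R u v))
  (R-sym : ∀ {u v} → R u v → R v u) (R-functional : ∀ {u v w} → R u v → R u w → v ≡ w)
  (R-irrefl : ∀ {u} → ¬ R u u) where

  empty-matching : Matching 0 n
  empty-matching = record
    { l = λ () ; r = λ () ; l-inj = λ { {()} } ; r-inj = λ { {()} } ; l≢r = λ () }

  -- The vertices still to be paired are listed by `f`, so that after two are removed the rest is
  -- again indexed by a `Fin`.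
  record Extension (f : Fin k → Fin n) : Set where
    field
      matching : Matching ⌊ k /2⌋ n
    open Matching matching public
    field
      l∈f    : ∀ i → ∃ λ s → f s ≡ l i
      r∈f    : ∀ i → ∃ λ s → f s ≡ r i
      R⇒Mate : ∀ s t → R (f s) (f t) → Mate (f s) (f t)

  Isolated : (f : Fin k → Fin n) → Fin k → Fin k → Set
  Isolated f i j = i ≢ j × (∀ s → R (f i) (f s) → s ≡ j) × (∀ s → R (f j) (f s) → s ≡ i)

  -- An edge of R is taken if one is left among the listed vertices; otherwise any two vertices do.
  -- Either way no edge of R joins the pair to the remaining vertices, so the recursion loses none.
  isolated-pair : (f : Fin (2 + k) → Fin n) → Inj f → ∃ λ i → ∃ λ j → Isolated f i j
  isolated-pair f f-inj with any? (λ i → any? (λ j → R? (f i) (f j)))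
  ... | yes (i , j , ij) = i , j , (λ { refl → R-irrefl ij }) ,
    (λ s is → f-inj (R-functional is ij)) , (λ s js → f-inj (R-functional js (R-sym ij)))
  ... | no none = zero , suc zero , (λ ()) ,
    (λ s r → ⊥-elim (none (_ , s , r))) , (λ s r → ⊥-elim (none (_ , s , r)))

  extend : ∀ (f : Fin k → Fin n) → Inj f → Extension f
  extend {zero} f _ = record
    { matching = empty-matching
    ; l∈f = λ () ; r∈f = λ () ; R⇒Mate = λ () }
  extend {suc zero} f _ = record
    { matching = empty-matching
    ; l∈f = λ () ; r∈f = λ () ; R⇒Mate = λ { zero zero r → ⊥-elim (R-irrefl r) } }
  extend {suc (suc k)} f f-inj
    with i , j , i≢j , i-isolated , j-isolated ← isolated-pair f f-inj = record
    { matching = record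
      { l = f i ∷ᶠ E.l
      ; r = f j ∷ᶠ E.r
      ; l-inj = Inj-∷ (λ t → fi≢ (E.l∈f t)) E.l-inj
      ; r-inj = Inj-∷ (λ t → fj≢ (E.r∈f t)) E.r-inj
      ; l≢r = λ where
          zero zero → i≢j ∘ f-inj
          zero (suc t) → fi≢ (E.r∈f t)
          (suc s) zero → fj≢ (E.l∈f s) ∘ sym
          (suc s) (suc t) → E.l≢r s t
      }
    ; l∈f = λ { zero → i , refl ; (suc t) → let s , eq = E.l∈f t in punchIn₂ i≢j s , eq }
    ; r∈f = λ { zero → j , refl ; (suc t) → let s , eq = E.r∈f t in punchIn₂ i≢j s , eq }
    ; R⇒Mate = λ s t → mate s t (s ≟ i) (s ≟ j) (t ≟ i) (t ≟ j)
    }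
    where
    f′ : Fin k → Fin n
    f′ = f ∘ punchIn₂ i≢j
    module E = Extension (extend f′ (punchIn₂-injective i≢j ∘ f-inj))
    fi≢ : ∀ {w} → (∃ λ s → f′ s ≡ w) → f i ≢ w
    fi≢ (s , refl) eq = punchIn₂≢x i≢j s (sym (f-inj eq))
    fj≢ : ∀ {w} → (∃ λ s → f′ s ≡ w) → f j ≢ w
    fj≢ (s , refl) eq = punchIn₂≢y i≢j s (sym (f-inj eq))
    Mate′ : Fin n → Fin n → Set
    Mate′ u v = ∃ λ t → (u ≡ (f i ∷ᶠ E.l) t × v ≡ (f j ∷ᶠ E.r) t) ⊎
                        (u ≡ (f j ∷ᶠ E.r) t × v ≡ (f i ∷ᶠ E.l) t)
    mate : ∀ s t → Dec (s ≡ i) → Dec (s ≡ j) → Dec (t ≡ i) → Dec (t ≡ j) →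
           R (f s) (f t) → Mate′ (f s) (f t)
    mate s t (yes refl) _ _ _ r with refl ← i-isolated t r = zero , inj₁ (refl , refl)
    mate s t (no _) (yes refl) _ _ r with refl ← j-isolated t r = zero , inj₂ (refl , refl)
    mate s t (no _) (no s≢j) (yes refl) _ r = ⊥-elim (s≢j (i-isolated s (R-sym r)))
    mate s t (no s≢i) (no _) (no _) (yes refl) r = ⊥-elim (s≢i (j-isolated s (R-sym r)))
    mate s t (no s≢i) (no s≢j) (no t≢i) (no t≢j) r
      with s′ , refl ← punchIn₂-surjective i≢j s≢i s≢j
         | t′ , refl ← punchIn₂-surjective i≢j t≢i t≢j
      with x , m ← E.R⇒Mate s′ t′ r = suc x , m

-- The dichotomy for the missing arcs.

Missing? : ∀ (D : Digraph n) u v → Dec (Missing D u v)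
Missing? D u v = ¬? (u ≟ v) ×-dec ¬? (u ⟶ v ∈? arcs D)

MinimallyConnected⇒3Cycle⊎Matching : ∀ {D : Digraph (2 + m)} → MinimallyConnected 2 m D →
  (∃ λ a → ∃ λ b → ∃ λ c → Distinct a b c × Complement D (Cyc a b c)) ⊎
  (Σ (Matching ⌊ 2 + m /2⌋ (2 + m)) λ P → Complement D (Matching.Mate P))
MinimallyConnected⇒3Cycle⊎Matching {m} {D} D-minimal
  with any? (λ a → any? (λ b → any? (λ c → Missing? D a b ×-dec Missing? D b c ×-dec ¬? (a ≟ c))))
... | yes (a , b , c , ab , bc , a≢c) = inj₁ (a , b , c , abc ,
  MinimallyConnected⇒Complement {D = D} (Cyc-extremal abc) (λ {u} {v} uv →
    decidable-stable (Cyc? a b c u v) λ ¬cyc →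
      unobstructed (missing-2-path-and-arc {D = D} ab bc a≢c uv ¬cyc))
    D-minimal)
  where
  unobstructed : ¬ Obstructed D
  unobstructed = MinimallyConnected⇒¬Obstructed {D = D} D-minimal
  abc : Distinct a b c
  abc = proj₁ ab , proj₁ bc , a≢c ∘ sym
... | no no-2-path = inj₂ (matching ,
  MinimallyConnected⇒Complement {D = D} (Mate-extremal matching)
    (λ uv → R⇒Mate _ _ (inj₁ uv)) D-minimal)
  where
  unobstructed : ¬ Obstructed D
  unobstructed = MinimallyConnected⇒¬Obstructed {D = D} D-minimal
  -- A priori only one of two opposite arcs may be missing, so the relation is symmetrised before it
  -- is extended to a matching. Minimality then forces every arc of the extension to be missing.
  Opposed : Fin (2 + m) → Fin (2 + m) → Set
  Opposed u v = Missing D u v ⊎ Missing D v u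
  no-turn : ∀ {u v w} → Missing D u v → Missing D v w → u ≡ w
  no-turn {u} {v} {w} uv vw = decidable-stable (u ≟ w) λ u≢w → no-2-path (u , v , w , uv , vw , u≢w)
  functional : ∀ {u v w} → Opposed u v → Opposed u w → v ≡ w
  functional {u} {v} {w} (inj₁ uv) (inj₁ uw) = decidable-stable (v ≟ w) λ v≢w →
    unobstructed (two-missing-out {D = D} uv uw v≢w)
  functional (inj₁ uv) (inj₂ wu) = sym (no-turn wu uv)
  functional (inj₂ vu) (inj₁ uw) = no-turn vu uw
  functional {u} {v} {w} (inj₂ vu) (inj₂ wu) = decidable-stable (v ≟ w) λ v≢w →
    unobstructed (two-missing-in {D = D} vu wu v≢w)
  symmetric : ∀ {u v} → Opposed u v → Opposed v u
  symmetric (inj₁ uv) = inj₂ uv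
  symmetric (inj₂ vu) = inj₁ vu
  irreflexive : ∀ {u} → ¬ Opposed u u
  irreflexive (inj₁ (u≢u , _)) = u≢u refl
  irreflexive (inj₂ (u≢u , _)) = u≢u refl
  opposed? : ∀ u v → Dec (Opposed u v)
  opposed? u v = Missing? D u v ⊎-dec Missing? D v u
  open ExtendMatching opposed? symmetric functional irreflexive
  open Extension (extend id id) using (matching; R⇒Mate)

-- Arc sets realising the patterns, and their sizes

∈-⋃⁺ : ∀ {f : Fin k → Subset n} {x} i → x ∈ f i → x ∈ ⋃ (tabulate f)
∈-⋃⁺ zero    x∈ = x∈p∪q⁺ (inj₁ x∈)
∈-⋃⁺ {f = f} (suc i) x∈ = x∈p∪q⁺ {p = f zero} (inj₂ (∈-⋃⁺ i x∈))

∈-⋃⁻ : ∀ (f : Fin k → Subset n) {x} → x ∈ ⋃ (tabulate f) → ∃ λ i → x ∈ f i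
∈-⋃⁻ {zero}  f x∈ = ⊥-elim (∉⊥ x∈)
∈-⋃⁻ {suc k} f x∈ with x∈p∪q⁻ (f zero) (⋃ (tabulate (f ∘ suc))) x∈
... | inj₁ x∈zero = zero , x∈zero
... | inj₂ x∈rest with i , x∈i ← ∈-⋃⁻ (f ∘ suc) x∈rest = suc i , x∈i

∣⋃∣≡ : ∀ {c} (f : Fin k → Subset n) → (∀ i j → i ≢ j → Empty (f i ∩ f j)) →
       (∀ i → ∣ f i ∣ ≡ c) → ∣ ⋃ (tabulate f) ∣ ≡ k * c
∣⋃∣≡ {zero}  {n} f _ _ = ∣⊥∣≡0 n
∣⋃∣≡ {suc k} f disjoint card = trans
  (∣p∪q∣≡∣p∣+∣q∣ (f zero) (⋃ (tabulate (f ∘ suc))) λ (x , x∈) →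
    let x∈zero , x∈rest = x∈p∩q⁻ (f zero) (⋃ (tabulate (f ∘ suc))) x∈
        i , x∈i = ∈-⋃⁻ (f ∘ suc) x∈rest
    in disjoint zero (suc i) (λ ()) (x , x∈p∩q⁺ (x∈zero , x∈i)))
  (cong₂ _+_ (card zero)
    (∣⋃∣≡ (f ∘ suc) (λ i j i≢j → disjoint (suc i) (suc j) (λ { refl → i≢j refl })) (card ∘ suc)))

∣p─q∣≡∣p∣∸∣q∣ : ∀ (p q : Subset n) → q ⊆ p → ∣ p ─ q ∣ ≡ ∣ p ∣ ∸ ∣ q ∣
∣p─q∣≡∣p∣∸∣q∣ []          []          _   = refl
∣p─q∣≡∣p∣∸∣q∣ (true  ∷ p) (true  ∷ q) q⊆p = ∣p─q∣≡∣p∣∸∣q∣ p q (drop-∷-⊆ q⊆p)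
∣p─q∣≡∣p∣∸∣q∣ (true  ∷ p) (false ∷ q) q⊆p = trans
  (cong suc (∣p─q∣≡∣p∣∸∣q∣ p q (drop-∷-⊆ q⊆p))) (sym (+-∸-assoc 1 (p⊆q⇒∣p∣≤∣q∣ (drop-∷-⊆ q⊆p))))
∣p─q∣≡∣p∣∸∣q∣ (false ∷ p) (false ∷ q) q⊆p = ∣p─q∣≡∣p∣∸∣q∣ p q (drop-∷-⊆ q⊆p)
∣p─q∣≡∣p∣∸∣q∣ (false ∷ p) (true  ∷ q) q⊆p with () ← q⊆p here

∈K : ∀ (u v : Fin n) → u ≢ v → u ⟶ v ∈ arcs (K n)
∈K {n} u v u≢v = ∈⟦⟧⁺ (notLoop? {n}) λ eq →
  u≢v (trans (sym (tail-⟶ u v)) (trans eq (head-⟶ u v)))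

-- The arcs form the complement of the diagonal, a union of n disjoint singletons.
size-K : ∀ n → size (K n) ≡ n * (n ∸ 1)
size-K n = begin
  ∣ arcs (K n) ∣         ≡⟨ cong ∣_∣ (⊆-antisym
                              (⊆-⟶ {n} λ u v uv∈ → x∉p⇒x∈∁p λ uv∈diagonal →
                                let i , uv≡ii = ∈-⋃⁻ loop uv∈diagonal
                                    u≡i , v≡i = combine-injective u v i i (x∈⁅y⁆⇒x≡y (i ⟶ i) uv≡ii)
                                in loop-free (K n) uv∈ (trans u≡i (sym v≡i)))
                              (⊆-⟶ {n} λ u v uv∈ → ∈K u v λ { refl →
                                x∈∁p⇒x∉p uv∈ (∈-⋃⁺ u (x∈⁅x⁆ (u ⟶ u))) })) ⟩
  ∣ ∁ (⋃ (tabulate loop)) ∣ ≡⟨ ∣∁p∣≡n∸∣p∣ (⋃ (tabulate loop)) ⟩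
  n * n ∸ ∣ ⋃ (tabulate loop) ∣ ≡⟨ cong (n * n ∸_) (∣⋃∣≡ loop
                              (λ i j i≢j (e , e∈) → let e∈i , e∈j = x∈p∩q⁻ (loop i) (loop j) e∈ in
                                i≢j (proj₁ (combine-injective i i j j
                                  (trans (sym (x∈⁅y⁆⇒x≡y (i ⟶ i) e∈i)) (x∈⁅y⁆⇒x≡y (j ⟶ j) e∈j)))))
                              (λ i → ∣⁅x⁆∣≡1 (i ⟶ i))) ⟩
  n * n ∸ n * 1          ≡⟨ *-distribˡ-∸ n n 1 ⟨
  n * (n ∸ 1)            ∎
  where
  open ≡-Reasoning
  loop : Fin n → ArcSet n
  loop i = ⁅ i ⟶ i ⁆

∈⁅a⟶b⁆⁺ : ∀ {u v a b : Fin n} → u ≡ a × v ≡ b → u ⟶ v ∈ ⁅ a ⟶ b ⁆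
∈⁅a⟶b⁆⁺ {a = a} {b} (refl , refl) = x∈⁅x⁆ (a ⟶ b)

∈⁅a⟶b⁆⁻ : ∀ {u v a b : Fin n} → u ⟶ v ∈ ⁅ a ⟶ b ⁆ → u ≡ a × v ≡ b
∈⁅a⟶b⁆⁻ {u = u} {v} {a} {b} uv∈ = combine-injective u v a b (x∈⁅y⁆⇒x≡y (a ⟶ b) uv∈)

-- This links the arc sets in which the patterns are defined and counted to the relations on
-- vertices with which the combinatorial argument works.
record Represents (M : ArcSet n) (R : Fin n → Fin n → Set) : Set where
  constructor represents
  field
    sound    : ∀ {u v} → u ⟶ v ∈ M → R u v
    complete : ∀ {u v} → R u v → u ⟶ v ∈ M

module _ {M : ArcSet n} {R : Fin n → Fin n → Set} (rep : Represents M R)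
         (R⇒≢ : ∀ {u v} → R u v → u ≢ v) where

  open Represents rep

  Represents⇒⊆K : M ⊆ arcs (K n)
  Represents⇒⊆K = ⊆-⟶ {n} λ u v uv∈ → ∈K u v (R⇒≢ (sound uv∈))

  Represents⇒Complement : Complement (K n ∖ M) R
  Represents⇒Complement = complement
    (λ {u} {v} r → R⇒≢ r , λ uv∈ → x∈p─q⇒x∉q (arcs (K n)) M uv∈ (complete r))
    λ {u} {v} u≢v ¬r → x∈p∧x∉q⇒x∈p─q (∈K u v u≢v) (¬r ∘ sound)

  Complement⇒arcs≡ : ∀ {D : Digraph n} → Complement D R → arcs D ≡ arcs (K n ∖ M)
  Complement⇒arcs≡ {D} (complement absent present) = ⊆-antisym
    (⊆-⟶ {n} λ u v uv∈ → x∈p∧x∉q⇒x∈p─q (∈K u v (loop-free D uv∈)) λ uv∈M →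
      proj₂ (absent (sound uv∈M)) uv∈)
    (⊆-⟶ {n} λ u v uv∈ → present (loop-free (K n ∖ M) uv∈)
      (x∈p─q⇒x∉q (arcs (K n)) M uv∈ ∘ complete))

  Complement⇒size : ∀ {D : Digraph n} → Complement D R → size D ≡ n * (n ∸ 1) ∸ ∣ M ∣
  Complement⇒size {D} c = trans (cong ∣_∣ (Complement⇒arcs≡ {D} c))
    (trans (∣p─q∣≡∣p∣∸∣q∣ (arcs (K n)) M Represents⇒⊆K) (cong (_∸ ∣ M ∣) (size-K n)))

arcs≡⇒≅ : ∀ {D E : Digraph n} → arcs D ≡ arcs E → D ≅ E
arcs≡⇒≅ eq = Permutation.id , λ x y → mk⇔ (subst (x ⟶ y ∈_) eq) (subst (x ⟶ y ∈_) (sym eq))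

cycleArcs : (a b c : Fin n) → ArcSet n
cycleArcs a b c = ⁅ a ⟶ b ⁆ ∪ ⁅ b ⟶ c ⁆ ∪ ⁅ c ⟶ a ⁆

cycleArcs-represents : ∀ (a b c : Fin n) → Represents (cycleArcs a b c) (Cyc a b c)
cycleArcs-represents {n} a b c = represents sound complete
  where
  sound : ∀ {u v} → u ⟶ v ∈ cycleArcs a b c → Cyc a b c u v
  sound uv∈ with x∈p∪q⁻ ⁅ a ⟶ b ⁆ (⁅ b ⟶ c ⁆ ∪ ⁅ c ⟶ a ⁆) uv∈
  ... | inj₁ ab = inj₁ (∈⁅a⟶b⁆⁻ ab)
  ... | inj₂ rest with x∈p∪q⁻ ⁅ b ⟶ c ⁆ ⁅ c ⟶ a ⁆ rest
  ...   | inj₁ bc = inj₂ (inj₁ (∈⁅a⟶b⁆⁻ bc))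
  ...   | inj₂ ca = inj₂ (inj₂ (∈⁅a⟶b⁆⁻ ca))
  complete : ∀ {u v} → Cyc a b c u v → u ⟶ v ∈ cycleArcs a b c
  complete (inj₁ ab) = x∈p∪q⁺ (inj₁ (∈⁅a⟶b⁆⁺ ab))
  complete (inj₂ (inj₁ bc)) = x∈p∪q⁺ {p = ⁅ a ⟶ b ⁆} (inj₂ (x∈p∪q⁺ (inj₁ (∈⁅a⟶b⁆⁺ bc))))
  complete (inj₂ (inj₂ ca)) =
    x∈p∪q⁺ {p = ⁅ a ⟶ b ⁆} (inj₂ (x∈p∪q⁺ {p = ⁅ b ⟶ c ⁆} (inj₂ (∈⁅a⟶b⁆⁺ ca))))

∣cycleArcs∣≡3 : ∀ {a b c : Fin n} → Distinct a b c → ∣ cycleArcs a b c ∣ ≡ 3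
∣cycleArcs∣≡3 {n} {a} {b} {c} (a≢b , b≢c , c≢a) = trans
  (∣p∪q∣≡∣p∣+∣q∣ ⁅ a ⟶ b ⁆ (⁅ b ⟶ c ⁆ ∪ ⁅ c ⟶ a ⁆) λ (e , e∈) →
    let e∈ab , e∈rest = x∈p∩q⁻ ⁅ a ⟶ b ⁆ (⁅ b ⟶ c ⁆ ∪ ⁅ c ⟶ a ⁆) e∈
        e≡ab = x∈⁅y⁆⇒x≡y (a ⟶ b) e∈ab
    in [ (λ e≡bc → a≢b (combine-injectiveˡ a b b c (trans (sym e≡ab) e≡bc)))
       , (λ e≡ca → c≢a (sym (combine-injectiveˡ a b c a (trans (sym e≡ab) e≡ca)))) ]′
       (∈⁅x⁆∪⁅y⁆⁻ e∈rest))
  (cong₂ _+_ (∣⁅x⁆∣≡1 (a ⟶ b))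
    (∣⁅x⁆∪⁅y⁆∣≡2 λ bc≡ca → b≢c (combine-injectiveˡ b c c a bc≡ca)))

Incident-endpoints : ∀ {M : ArcSet n} {u v : Fin n} → u ⟶ v ∈ M →
                     u ∈ ⟦ incident? {n} M ⟧ × v ∈ ⟦ incident? {n} M ⟧
Incident-endpoints {n} {M} {u} {v} uv∈ =
  ∈⟦⟧⁺ (incident? {n} M) (v , inj₁ uv∈) , ∈⟦⟧⁺ (incident? {n} M) (u , inj₂ uv∈)

cycleArcs-is-3-cycle : ∀ {a b c : Fin n} → Distinct a b c → (M⊆K : cycleArcs a b c ⊆ arcs (K n)) →
                       IsDirected3Cycle (arcInduced (K n) (cycleArcs a b c) M⊆K)
cycleArcs-is-3-cycle {n} {a} {b} {c} (a≢b , b≢c , c≢a) M⊆K =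
  a , b , c , a≢b , b≢c , c≢a , ⊆-antisym V⊆ ⊆V , refl
  where
  M = cycleArcs a b c
  W = ⁅ a ⁆ ∪ ⁅ b ⁆ ∪ ⁅ c ⁆
  open Represents (cycleArcs-represents a b c)
  a∈ : a ∈ W
  a∈ = x∈p∪q⁺ (inj₁ (x∈⁅x⁆ a))
  b∈ : b ∈ W
  b∈ = x∈p∪q⁺ {p = ⁅ a ⁆} (inj₂ (x∈⁅x⁆∪⁅y⁆ b c))
  c∈ : c ∈ W
  c∈ = x∈p∪q⁺ {p = ⁅ a ⁆} (inj₂ (y∈⁅x⁆∪⁅y⁆ b c))
  endpoints : ∀ {u v} → Cyc a b c u v → u ∈ W × v ∈ W
  endpoints (inj₁ (refl , refl)) = a∈ , b∈
  endpoints (inj₂ (inj₁ (refl , refl))) = b∈ , c∈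
  endpoints (inj₂ (inj₂ (refl , refl))) = c∈ , a∈
  V⊆ : ⟦ incident? {n} M ⟧ ⊆ W
  V⊆ x∈ with ∈⟦⟧⁻ (incident? {n} M) x∈
  ... | _ , inj₁ xy∈ = proj₁ (endpoints (sound xy∈))
  ... | _ , inj₂ yx∈ = proj₂ (endpoints (sound yx∈))
  ab∈ : a ⟶ b ∈ M
  ab∈ = complete (inj₁ (refl , refl))
  bc∈ : b ⟶ c ∈ M
  bc∈ = complete (inj₂ (inj₁ (refl , refl)))
  ⊆V : W ⊆ ⟦ incident? {n} M ⟧
  ⊆V x∈ with x∈p∪q⁻ ⁅ a ⁆ (⁅ b ⁆ ∪ ⁅ c ⁆) x∈
  ... | inj₁ x∈a with refl ← x∈⁅y⁆⇒x≡y a x∈a = proj₁ (Incident-endpoints {M = M} ab∈)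
  ... | inj₂ x∈bc with ∈⁅x⁆∪⁅y⁆⁻ x∈bc
  ...   | inj₁ refl = proj₂ (Incident-endpoints {M = M} ab∈)
  ...   | inj₂ refl = proj₂ (Incident-endpoints {M = M} bc∈)

3-cycle⇒Represents : ∀ {M : ArcSet n} {M⊆K : M ⊆ arcs (K n)} →
                     IsDirected3Cycle (arcInduced (K n) M M⊆K) →
                     ∃ λ a → ∃ λ b → ∃ λ c → Distinct a b c × Represents M (Cyc a b c)
3-cycle⇒Represents (a , b , c , a≢b , b≢c , c≢a , _ , refl) =
  a , b , c , (a≢b , b≢c , c≢a) , cycleArcs-represents a b c

module MatchingArcs (P : Matching q n) where

  open Matching P

  pairArcs : Fin q → ArcSet n
  pairArcs i = ⁅ l i ⟶ r i ⁆ ∪ ⁅ r i ⟶ l i ⁆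

  pairEnds : Fin q → Subset n
  pairEnds i = ⁅ l i ⁆ ∪ ⁅ r i ⁆

  matchingArcs : ArcSet n
  matchingArcs = ⋃ (tabulate pairArcs)

  ∈pairArcs⁻ : ∀ {u v i} → u ⟶ v ∈ pairArcs i → (u ≡ l i × v ≡ r i) ⊎ (u ≡ r i × v ≡ l i)
  ∈pairArcs⁻ {i = i} uv∈ with x∈p∪q⁻ ⁅ l i ⟶ r i ⁆ ⁅ r i ⟶ l i ⁆ uv∈
  ... | inj₁ lr = inj₁ (∈⁅a⟶b⁆⁻ lr)
  ... | inj₂ rl = inj₂ (∈⁅a⟶b⁆⁻ rl)

  ∈pairArcs⁺ : ∀ {u v i} → (u ≡ l i × v ≡ r i) ⊎ (u ≡ r i × v ≡ l i) → u ⟶ v ∈ pairArcs i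
  ∈pairArcs⁺ {i = i} (inj₁ lr) = x∈p∪q⁺ (inj₁ (∈⁅a⟶b⁆⁺ lr))
  ∈pairArcs⁺ {i = i} (inj₂ rl) = x∈p∪q⁺ {p = ⁅ l i ⟶ r i ⁆} (inj₂ (∈⁅a⟶b⁆⁺ rl))

  pairArcs-ends : ∀ {u v i} → u ⟶ v ∈ pairArcs i → u ∈ pairEnds i × v ∈ pairEnds i
  pairArcs-ends {i = i} uv∈ with ∈pairArcs⁻ uv∈
  ... | inj₁ (refl , refl) = x∈⁅x⁆∪⁅y⁆ (l i) (r i) , y∈⁅x⁆∪⁅y⁆ (l i) (r i)
  ... | inj₂ (refl , refl) = y∈⁅x⁆∪⁅y⁆ (l i) (r i) , x∈⁅x⁆∪⁅y⁆ (l i) (r i)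

  matchingArcs-represents : Represents matchingArcs Mate
  matchingArcs-represents = represents
    (λ uv∈ → let i , uv∈i = ∈-⋃⁻ pairArcs uv∈ in i , ∈pairArcs⁻ uv∈i)
    λ (i , uv) → ∈-⋃⁺ i (∈pairArcs⁺ uv)

  pairEnds-disjoint : ∀ i j → i ≢ j → Empty (pairEnds i ∩ pairEnds j)
  pairEnds-disjoint i j i≢j (x , x∈) with x∈i , x∈j ← x∈p∩q⁻ (pairEnds i) (pairEnds j) x∈
    with ∈⁅x⁆∪⁅y⁆⁻ x∈i | ∈⁅x⁆∪⁅y⁆⁻ x∈j
  ... | inj₁ x≡l | inj₁ x≡l′ = i≢j (l-inj (trans (sym x≡l) x≡l′))
  ... | inj₁ x≡l | inj₂ x≡r  = l≢r i j (trans (sym x≡l) x≡r)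
  ... | inj₂ x≡r | inj₁ x≡l  = l≢r j i (trans (sym x≡l) x≡r)
  ... | inj₂ x≡r | inj₂ x≡r′ = i≢j (r-inj (trans (sym x≡r) x≡r′))

  pairArcs-disjoint : ∀ i j → i ≢ j → Empty (pairArcs i ∩ pairArcs j)
  pairArcs-disjoint i j i≢j (e , e∈) =
    let e∈i , e∈j = x∈p∩q⁻ (pairArcs i) (pairArcs j) e∈
        ends = λ {t} (e∈t : e ∈ pairArcs t) →
          proj₁ (pairArcs-ends (subst (_∈ pairArcs t) (sym (tail⟶head {n} e)) e∈t))
    in pairEnds-disjoint i j i≢j (tail {n} e , x∈p∩q⁺ (ends {i} e∈i , ends {j} e∈j))

  ∣matchingArcs∣ : ∣ matchingArcs ∣ ≡ q * 2
  ∣matchingArcs∣ = ∣⋃∣≡ pairArcs pairArcs-disjoint λ i →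
    ∣⁅x⁆∪⁅y⁆∣≡2 λ lr≡rl → l≢r i i (combine-injectiveˡ (l i) (r i) (r i) (l i) lr≡rl)

  matchingArcs-is-union : (M⊆K : matchingArcs ⊆ arcs (K n)) →
                          IsUnionOfDisjoint2Cycles q (arcInduced (K n) matchingArcs M⊆K)
  matchingArcs-is-union M⊆K = C ,
    (λ i → l i , r i , l≢r i i , refl , refl) , pairEnds-disjoint , ⊆-antisym V⊆ ⊆V , refl
    where
    C : Fin q → Subgraph (K n)
    C i = subgraph (pairEnds i) (pairArcs i) (M⊆K ∘ ∈-⋃⁺ i) λ u v → pairArcs-ends
    V⊆ : ⟦ incident? {n} matchingArcs ⟧ ⊆ ⋃ (tabulate pairEnds)
    V⊆ x∈ with ∈⟦⟧⁻ (incident? {n} matchingArcs) x∈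
    ... | _ , inj₁ xy∈ = let i , xy∈i = ∈-⋃⁻ pairArcs xy∈ in ∈-⋃⁺ i (proj₁ (pairArcs-ends xy∈i))
    ... | _ , inj₂ yx∈ = let i , yx∈i = ∈-⋃⁻ pairArcs yx∈ in ∈-⋃⁺ i (proj₂ (pairArcs-ends yx∈i))
    lr∈ : ∀ i → l i ∈ ⟦ incident? {n} matchingArcs ⟧ × r i ∈ ⟦ incident? {n} matchingArcs ⟧
    lr∈ i = Incident-endpoints {M = matchingArcs} (∈-⋃⁺ i (∈pairArcs⁺ (inj₁ (refl , refl))))
    ⊆V : ⋃ (tabulate pairEnds) ⊆ ⟦ incident? {n} matchingArcs ⟧
    ⊆V x∈ with i , x∈i ← ∈-⋃⁻ pairEnds x∈ with ∈⁅x⁆∪⁅y⁆⁻ x∈i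
    ... | inj₁ refl = proj₁ (lr∈ i)
    ... | inj₂ refl = proj₂ (lr∈ i)

union⇒Represents : ∀ {M : ArcSet n} {M⊆K : M ⊆ arcs (K n)} →
                   IsUnionOfDisjoint2Cycles q (arcInduced (K n) M M⊆K) →
                   Σ (Matching q n) λ P → Represents M (Matching.Mate P)
union⇒Represents {n} {q} {M} (C , is-2-cycle , disjoint , _ , M≡) = P , represents sound complete
  where
  a b : Fin q → Fin n
  a i = proj₁ (is-2-cycle i)
  b i = proj₁ (proj₂ (is-2-cycle i))
  a≢b : ∀ i → a i ≢ b i
  a≢b i = proj₁ (proj₂ (proj₂ (is-2-cycle i)))
  VC≡ : ∀ i → V (C i) ≡ ⁅ a i ⁆ ∪ ⁅ b i ⁆
  VC≡ i = proj₁ (proj₂ (proj₂ (proj₂ (is-2-cycle i))))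
  AC≡ : ∀ i → A (C i) ≡ ⁅ a i ⟶ b i ⁆ ∪ ⁅ b i ⟶ a i ⁆
  AC≡ i = proj₂ (proj₂ (proj₂ (proj₂ (is-2-cycle i))))
  a∈C : ∀ i → a i ∈ V (C i)
  a∈C i = subst (a i ∈_) (sym (VC≡ i)) (x∈⁅x⁆∪⁅y⁆ (a i) (b i))
  b∈C : ∀ i → b i ∈ V (C i)
  b∈C i = subst (b i ∈_) (sym (VC≡ i)) (y∈⁅x⁆∪⁅y⁆ (a i) (b i))
  shared⇒≡ : ∀ {i j x} → x ∈ V (C i) → x ∈ V (C j) → i ≡ j
  shared⇒≡ {i} {j} {x} x∈i x∈j = decidable-stable (i ≟ j) λ i≢j →
    disjoint i j i≢j (x , x∈p∩q⁺ (x∈i , x∈j))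
  P : Matching q n
  P = record
    { l = a ; r = b
    ; l-inj = λ {i} {j} eq → shared⇒≡ (a∈C i) (subst (_∈ V (C j)) (sym eq) (a∈C j))
    ; r-inj = λ {i} {j} eq → shared⇒≡ (b∈C i) (subst (_∈ V (C j)) (sym eq) (b∈C j))
    -- A vertex shared by two cycles makes their indices equal, and then the two ends of a single
    -- cycle would coincide.
    ; l≢r = λ i j eq → a≢b i (trans eq (cong b (sym
        (shared⇒≡ (a∈C i) (subst (_∈ V (C j)) (sym eq) (b∈C j))))))
    }
  open MatchingArcs P using (∈pairArcs⁺; ∈pairArcs⁻)
  sound : ∀ {u v} → u ⟶ v ∈ M → Matching.Mate P u v
  sound {u} {v} uv∈ =
    let i , uv∈i = ∈-⋃⁻ (A ∘ C) (subst (u ⟶ v ∈_) M≡ uv∈)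
    in i , ∈pairArcs⁻ (subst (u ⟶ v ∈_) (AC≡ i) uv∈i)
  complete : ∀ {u v} → Matching.Mate P u v → u ⟶ v ∈ M
  complete {u} {v} (i , uv) = subst (u ⟶ v ∈_) (sym M≡)
    (∈-⋃⁺ {f = A ∘ C} i (subst (u ⟶ v ∈_) (sym (AC≡ i)) (∈pairArcs⁺ uv)))

-- Invariance of the patterns under isomorphism.

module Transport {D E : Digraph n} (iso : D ≅ E) where

  σ : Permutation′ n
  σ = proj₁ iso

  to from : Fin n → Fin n
  to   = σ ⟨$⟩ʳ_
  from = σ ⟨$⟩ˡ_

  to-inj : Inj to
  to-inj eq = trans (sym (inverseˡ σ)) (trans (cong from eq) (inverseˡ σ))

  from-inj : Inj from
  from-inj eq = trans (sym (inverseʳ σ)) (trans (cong to eq) (inverseʳ σ))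

  adjoint⁺ : ∀ {u a} → to u ≡ a → u ≡ from a
  adjoint⁺ refl = sym (inverseˡ σ)

  adjoint⁻ : ∀ {u a} → u ≡ from a → to u ≡ a
  adjoint⁻ refl = inverseʳ σ

  Complement-pullback : ∀ {R R′ : Fin n → Fin n → Set} →
    (∀ {u v} → R′ (to u) (to v) → R u v) → (∀ {u v} → R u v → R′ (to u) (to v)) →
    Complement E R′ → Complement D R
  Complement-pullback R′⇒R R⇒R′ (complement absent present) = complement
    (λ {u} {v} r → let to-u≢to-v , uv∉ = absent (R⇒R′ r) in
      (λ { refl → to-u≢to-v refl }) , uv∉ ∘ Equivalence.to (proj₂ iso u v))
    λ {u} {v} u≢v ¬r → Equivalence.from (proj₂ iso u v) (present (u≢v ∘ to-inj) (¬r ∘ R′⇒R))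

  Distinct-from : ∀ {a b c} → Distinct a b c → Distinct (from a) (from b) (from c)
  Distinct-from (a≢b , b≢c , c≢a) = a≢b ∘ from-inj , b≢c ∘ from-inj , c≢a ∘ from-inj

  Cyc-from⁺ : ∀ {a b c u v} → Cyc a b c (to u) (to v) → Cyc (from a) (from b) (from c) u v
  Cyc-from⁺ = Sum.map at (Sum.map at at)
    where
    at : ∀ {a b u v} → to u ≡ a × to v ≡ b → u ≡ from a × v ≡ from b
    at = Product.map adjoint⁺ adjoint⁺

  Cyc-from⁻ : ∀ {a b c u v} → Cyc (from a) (from b) (from c) u v → Cyc a b c (to u) (to v)
  Cyc-from⁻ = Sum.map at (Sum.map at at)
    where
    at : ∀ {a b u v} → u ≡ from a × v ≡ from b → to u ≡ a × to v ≡ b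
    at = Product.map adjoint⁻ adjoint⁻

  Complement-3-cycle : ∀ {a b c} → Complement E (Cyc a b c) →
                       Complement D (Cyc (from a) (from b) (from c))
  Complement-3-cycle = Complement-pullback Cyc-from⁺ Cyc-from⁻

  Matching-from : Matching q n → Matching q n
  Matching-from P = record
    { l = from ∘ l ; r = from ∘ r
    ; l-inj = l-inj ∘ from-inj ; r-inj = r-inj ∘ from-inj ; l≢r = λ i j → l≢r i j ∘ from-inj }
    where open Matching P

  Complement-matching : ∀ {P : Matching q n} → Complement E (Matching.Mate P) →
                        Complement D (Matching.Mate (Matching-from P))
  Complement-matching = Complement-pullback
    (λ (i , uv) → i , Sum.map (Product.map adjoint⁺ adjoint⁺) (Product.map adjoint⁺ adjoint⁺) uv)
    (λ (i , uv) → i , Sum.map (Product.map adjoint⁻ adjoint⁻) (Product.map adjoint⁻ adjoint⁻) uv)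

-- The extremal sizes and the characterisation.

size-3-cycle : ∀ {D : Digraph (2 + m)} {a b c} → Distinct a b c → Complement D (Cyc a b c) →
               size D ≡ (2 + m) * (1 + m) ∸ 3
size-3-cycle {m} {D} {a} {b} {c} abc D-complement = trans
  (Complement⇒size (cycleArcs-represents a b c) (Extremal.R⇒≢ (Cyc-extremal abc)) {D} D-complement)
  (cong ((2 + m) * (1 + m) ∸_) (∣cycleArcs∣≡3 abc))

size-matching : ∀ {D : Digraph (2 + m)} (P : Matching ⌊ 2 + m /2⌋ (2 + m)) →
                Complement D (Matching.Mate P) → size D ≡ (2 + m) * (1 + m) ∸ 2 * ⌊ 2 + m /2⌋
size-matching {m} {D} P D-complement = trans
  (Complement⇒size matchingArcs-represents (Extremal.R⇒≢ (Mate-extremal P)) {D} D-complement)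
  (cong ((2 + m) * (1 + m) ∸_) (trans ∣matchingArcs∣ (*-comm ⌊ 2 + m /2⌋ 2)))
  where open MatchingArcs P

perfect-matching : ∀ n → Matching ⌊ n /2⌋ n
perfect-matching n = ExtendMatching.Extension.matching
  (ExtendMatching.extend {R = λ _ _ → Empty⊥} (λ _ _ → no id) id (λ ()) id id id)

3-cycle-minimal : ∀ {a b c : Fin (2 + m)} → Distinct a b c →
                  Σ (𝔉 (2 + m) 2 m) λ D → Complement (proj₁ D) (Cyc a b c)
3-cycle-minimal {m} {a} {b} {c} abc =
  (D , Complement⇒MinimallyConnected {D = D} (Cyc-extremal abc) D-complement) , D-complement
  where
  D = K (2 + m) ∖ cycleArcs a b c
  D-complement : Complement D (Cyc a b c)
  D-complement = Represents⇒Complement (cycleArcs-represents a b c) (Extremal.R⇒≢ (Cyc-extremal abc))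

matching-minimal : ∀ (P : Matching ⌊ 2 + m /2⌋ (2 + m)) →
                   Σ (𝔉 (2 + m) 2 m) λ D → Complement (proj₁ D) (Matching.Mate P)
matching-minimal {m} P =
  (D , Complement⇒MinimallyConnected {D = D} (Mate-extremal P) D-complement) , D-complement
  where
  open MatchingArcs P
  open Matching P using (Mate)
  D = K (2 + m) ∖ matchingArcs
  D-complement : Complement D Mate
  D-complement = Represents⇒Complement matchingArcs-represents (Extremal.R⇒≢ (Mate-extremal P))

f-value F-value : ℕ → ℕ
f-value n = n * (n ∸ 1) ∸ 2 * ⌊ n /2⌋
F-value n = n * (n ∸ 1) ∸ 3

-- From n = 4 on the matching removes at least 2 · 2 = 4 arcs, more than the three of the 3-cycle.
-- For n = 3 it removes only two and the order is reversed.
f≤F : 4 ≤ n → f-value n ≤ F-value n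
f≤F {n} 4≤n = ∸-monoʳ-≤ (n * (n ∸ 1))
  (≤-trans (n≤1+n 3) (*-monoʳ-≤ 2 (⌊n/2⌋-mono 4≤n)))

sizes : (D : 𝔉 (2 + m) 2 m) → size (proj₁ D) ≡ F-value (2 + m) ⊎ size (proj₁ D) ≡ f-value (2 + m)
sizes (D , D-minimal) with MinimallyConnected⇒3Cycle⊎Matching {D = D} D-minimal
... | inj₁ (a , b , c , abc , D-complement) = inj₁ (size-3-cycle {D = D} abc D-complement)
... | inj₂ (P , D-complement) = inj₂ (size-matching {D = D} P D-complement)

extremal-sizes : ∀ m → 4 ≤ 2 + m →
                 Isf (2 + m) 2 m (f-value (2 + m)) × IsF (2 + m) 2 m (F-value (2 + m))
extremal-sizes zero          (s≤s (s≤s ()))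
extremal-sizes (suc zero)    (s≤s (s≤s (s≤s ())))
extremal-sizes (suc (suc k)) 4≤n =
  ((proj₁ min , size-matching {D = proj₁ (proj₁ min)} P (proj₂ min)) , lower) ,
  ((proj₁ max , size-3-cycle {D = proj₁ (proj₁ max)} distinct (proj₂ max)) , upper)
  where
  P = perfect-matching (4 + k)
  min = matching-minimal P
  distinct : Distinct {4 + k} zero (suc zero) (suc (suc zero))
  distinct = (λ ()) , (λ ()) , λ ()
  max = 3-cycle-minimal distinct
  lower : ∀ p → Σ (𝔉 (4 + k) 2 (2 + k)) (λ D → size (proj₁ D) ≡ p) → f-value (4 + k) ≤ p
  lower _ (D , refl) with sizes D
  ... | inj₁ eq = ≤-trans (f≤F 4≤n) (≤-reflexive (sym eq))
  ... | inj₂ eq = ≤-reflexive (sym eq)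
  upper : ∀ p → Σ (𝔉 (4 + k) 2 (2 + k)) (λ D → size (proj₁ D) ≡ p) → p ≤ F-value (4 + k)
  upper _ (D , refl) with sizes D
  ... | inj₁ eq = ≤-reflexive eq
  ... | inj₂ eq = ≤-trans (≤-reflexive eq) (f≤F 4≤n)

DeletedPattern : (n : ℕ) → Digraph n → Set
DeletedPattern n D =
  Σ (ArcSet n) λ M → Σ (M ⊆ arcs (K n)) λ M⊆K →
    (IsDirected3Cycle (arcInduced (K n) M M⊆K)
      ⊎ IsUnionOfDisjoint2Cycles ⌊ n /2⌋ (arcInduced (K n) M M⊆K))
    × D ≅ (K n ∖ M)

minimal⇒pattern : ∀ (D : Digraph (2 + m)) → MinimallyConnected 2 m D → DeletedPattern (2 + m) D
minimal⇒pattern {m} D D-minimal with MinimallyConnected⇒3Cycle⊎Matching {D = D} D-minimal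
... | inj₁ (a , b , c , abc , D-complement) = _ , M⊆K , inj₁ (cycleArcs-is-3-cycle abc M⊆K) ,
  arcs≡⇒≅ {D = D} {K (2 + m) ∖ cycleArcs a b c}
    (Complement⇒arcs≡ (cycleArcs-represents a b c) R⇒≢ {D} D-complement)
  where
  R⇒≢ : ∀ {u v} → Cyc a b c u v → u ≢ v
  R⇒≢ = Extremal.R⇒≢ (Cyc-extremal abc)
  M⊆K : cycleArcs a b c ⊆ arcs (K (2 + m))
  M⊆K = Represents⇒⊆K (cycleArcs-represents a b c) R⇒≢
... | inj₂ (P , D-complement) = _ , M⊆K , inj₂ (matchingArcs-is-union M⊆K) ,
  arcs≡⇒≅ {D = D} {K (2 + m) ∖ MatchingArcs.matchingArcs P}
    (Complement⇒arcs≡ matchingArcs-represents R⇒≢ {D} D-complement)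
  where
  open MatchingArcs P
  R⇒≢ : ∀ {u v} → Matching.Mate P u v → u ≢ v
  R⇒≢ = Extremal.R⇒≢ (Mate-extremal P)
  M⊆K : matchingArcs ⊆ arcs (K (2 + m))
  M⊆K = Represents⇒⊆K matchingArcs-represents R⇒≢

pattern⇒minimal : ∀ (D : Digraph (2 + m)) → DeletedPattern (2 + m) D → MinimallyConnected 2 m D
pattern⇒minimal {m} D (M , M⊆K , inj₁ 3-cycle , iso)
  with a , b , c , abc , M-represents ← 3-cycle⇒Represents {M = M} {M⊆K} 3-cycle =
  Complement⇒MinimallyConnected {D = D} (Cyc-extremal (Distinct-from abc))
    (Complement-3-cycle (Represents⇒Complement M-represents (Extremal.R⇒≢ (Cyc-extremal abc))))
  where open Transport {D = D} {K (2 + m) ∖ M} iso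
pattern⇒minimal {m} D (M , M⊆K , inj₂ union , iso)
  with P , M-represents ← union⇒Represents {M = M} {M⊆K} union =
  Complement⇒MinimallyConnected {D = D} (Mate-extremal (Matching-from P))
    (Complement-matching {P = P} (Represents⇒Complement M-represents (Extremal.R⇒≢ (Mate-extremal P))))
  where open Transport {D = D} {K (2 + m) ∖ M} iso

theorem3p5 : ∀ (n : ℕ) → 2 ≤ n →
    (∀ (D : Digraph n) →
    MinimallyConnected 2 (n ∸ 2) D ⇔
    (Σ (ArcSet n) λ M → Σ (M ⊆ arcs (K n)) λ M⊆K →
    (IsDirected3Cycle (arcInduced (K n) M M⊆K)
    ⊎ IsUnionOfDisjoint2Cycles ⌊ n /2⌋ (arcInduced (K n) M M⊆K))
    × D ≅ (K n ∖ M)))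
    × (4 ≤ n →
    Isf n 2 (n ∸ 2) (n * (n ∸ 1) ∸ 2 * ⌊ n /2⌋)
    × IsF n 2 (n ∸ 2) (n * (n ∸ 1) ∸ 3))
theorem3p5 (suc zero) (s≤s ())
theorem3p5 (suc (suc m)) _ =
  (λ D → mk⇔ (minimal⇒pattern D) (pattern⇒minimal D)) , extremal-sizes m
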